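{- Let $\mathcal V$ be a variety (of finite signature, with a c.e. set of equational laws) such that the class $\mathcal V_{f.g.}$ of finitely generated c.e. algebras in $\mathcal V$ has the ascending chain condition on congruence lattices. Then $\cong_{\mathcal V_{f.g.}}\ \le_c\ =^{ce}$.
   Context: $W_e$ denotes the $e$-th c.e. set and $\langle\cdot,\cdot\rangle$ a computable pairing function. A variety $\mathcal V$ is the class of all algebras in a fixed algebraic signature (function symbols only, constants allowed) satisfying a fixed c.e. set of equational laws; for finitely generated classes the signature is finite. For $k\ge1$ let $X_k=\{x_0,\dots,x_{k-1}\}$ and fix a computable bijective coding of pairs of terms over $X_k$ by natural numbers. For a set $R$ of such pairs, $\langle X_k\mid R\rangle_{\mathcal V}$ is the term algebra $\mathcal T(X_k)$ modulo the smallest congruence containing $R$ and all instances of the laws of $\mathcal V$. The class $\mathcal V_{f.g.}$ consists of the algebras $\mathcal V_{f.g.}[\langle k,e\rangle]=\langle X_k\mid W_e\rangle_{\mathcal V}$ ($k\ge1$, $e\in\mathbb N$), and $\cong_{\mathcal V_{f.g.}}$ is the equivalence relation on codes given by $\langle k,e\rangle\cong_{\mathcal V_{f.g.}}\langle j,i\rangle$ iff $\mathcal V_{f.g.}[\langle k,e\rangle]\cong\mathcal V_{f.g.}[\langle j,i\rangle]$. A class has the ascending chain condition (ACC) if for every algebra in it, every ascending chain of congruences $\theta_0\subseteq\theta_1\subseteq\cdots$ is eventually constant. The relation $=^{ce}$ on $\mathbb N$ is: $e=^{ce}i$ iff $W_e=W_i$. For equivalence relations $E,F$ on $\mathbb N$,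 $E\le_c F$ means there is a total computable $h$ with $x\,E\,y\iff h(x)\,F\,h(y)$ for all $x,y$. -}

module Defs where

open import Data.Nat using (ℕ; zero; suc; _+_; _<_; _≤_; _<?_)
open import Data.Fin using (Fin; fromℕ<)
import Data.Fin as Fin
open import Data.Product using (Σ; ∃; _×_; _,_; proj₁; proj₂)
open import Relation.Nullary using (yes; no)
open import Function.Bundles using (_⇔_)

-- Computable pairing function (Cantor pairing) and its inverse.
-- unpair enumerates ℕ × ℕ diagonal by diagonal:
--   0 ↦ (0,0), 1 ↦ (0,1), 2 ↦ (1,0), 3 ↦ (0,2), 4 ↦ (1,1), …
-- pair is its inverse: pair a b = T (a + b) + a, T = triangular numbers.

tri : ℕ → ℕ
tri zero    = zero
tri (suc d) = suc d + tri d

pair : ℕ → ℕ → ℕ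
pair a b = tri (a + b) + a

unpair : ℕ → ℕ × ℕ
unpair zero = 0 , 0
unpair (suc n) with unpair n
... | a , zero  = 0 , suc a
... | a , suc b = suc a , b

nth : ℕ → ℕ → ℕ
nth zero    r = proj₁ (unpair r)
nth (suc i) r = nth i (proj₂ (unpair r))

data Code : Set where
  cZero cSucc cId cFst cSnd : Code
  cComp : Code → Code → Code
  cPair : Code → Code → Code
  cRec  : Code → Code → Code
  cMin  : Code → Code

infix 4 _⟨_⟩⇓_
data _⟨_⟩⇓_ : Code → ℕ → ℕ → Set where
  ev-zero : ∀ {x} → cZero ⟨ x ⟩⇓ 0
  ev-succ : ∀ {x} → cSucc ⟨ x ⟩⇓ suc x
  ev-id   : ∀ {x} → cId ⟨ x ⟩⇓ x
  ev-fst  : ∀ {a b} → cFst ⟨ pair a b ⟩⇓ a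
  ev-snd  : ∀ {a b} → cSnd ⟨ pair a b ⟩⇓ b
  ev-comp : ∀ {f g x y z} → g ⟨ x ⟩⇓ y → f ⟨ y ⟩⇓ z → cComp f g ⟨ x ⟩⇓ z
  ev-pair : ∀ {f g x y z} → f ⟨ x ⟩⇓ y → g ⟨ x ⟩⇓ z → cPair f g ⟨ x ⟩⇓ pair y z
  ev-rec0 : ∀ {f g a y} → f ⟨ a ⟩⇓ y → cRec f g ⟨ pair a 0 ⟩⇓ y
  ev-recS : ∀ {f g a n z y} → cRec f g ⟨ pair a n ⟩⇓ z →
            g ⟨ pair a (pair n z) ⟩⇓ y → cRec f g ⟨ pair a (suc n) ⟩⇓ y
  ev-min  : ∀ {f a n} → f ⟨ pair a n ⟩⇓ 0 →
            (∀ m → m < n → Σ ℕ (λ k → f ⟨ pair a m ⟩⇓ suc k)) →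
            cMin f ⟨ a ⟩⇓ n

-- Gödel numbering of codes (surjective): decoding with fuel.
decodeC : ℕ → ℕ → Code
decodeC zero _ = cZero
decodeC (suc fuel) n with unpair n
... | 0 , _ = cZero
... | 1 , _ = cSucc
... | 2 , _ = cId
... | 3 , _ = cFst
... | 4 , _ = cSnd
... | 5 , r = cComp (decodeC fuel (nth 0 r)) (decodeC fuel (nth 1 r))
... | 6 , r = cPair (decodeC fuel (nth 0 r)) (decodeC fuel (nth 1 r))
... | 7 , r = cRec (decodeC fuel (nth 0 r)) (decodeC fuel (nth 1 r))
... | 8 , r = cMin (decodeC fuel r)
... | _ , _ = cZero

φ : ℕ → Code
φ e = decodeC (suc e) e

_∈W_ : ℕ → ℕ → Set
x ∈W e = ∃ λ y → φ e ⟨ x ⟩⇓ y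

Computable : (ℕ → ℕ) → Set
Computable h = Σ Code λ c → ∀ x → c ⟨ x ⟩⇓ h x

_≤c_ : (ℕ → ℕ → Set) → (ℕ → ℕ → Set) → Set
E ≤c F = Σ (ℕ → ℕ) λ h → Computable h × (∀ x y → E x y ⇔ F (h x) (h y))

_=ce_ : ℕ → ℕ → Set
e =ce i = ∀ x → x ∈W e ⇔ x ∈W i

record Variety : Set where
  field
    nsym   : ℕ
    arity  : Fin nsym → ℕ
    lawIdx : ℕ                 -- the laws are the (decoded) elements of W_lawIdx

module _ (V : Variety) where
  open Variety V

  data Term (k : ℕ) : Set where
    var : Fin k → Term k
    app : (s : Fin nsym) → (Fin (arity s) → Term k) → Term k

  substT : ∀ {m k} → (Fin m → Term k) → Term m → Term k
  substT σ (var i)    = σ i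
  substT σ (app s ts) = app s (λ i → substT σ (ts i))

  -- computable (surjective) coding of terms over X_{k+1} by naturals
  decodeT : (k : ℕ) → ℕ → ℕ → Term (suc k)
  decodeT k zero _ = var Fin.zero
  decodeT k (suc fuel) n with unpair n
  ... | zero , r = var (Fin.fromℕ< (Data.Nat.DivMod.m%n<n r (suc k)))
    where import Data.Nat.DivMod
  ... | suc s , r with s <? nsym
  ...   | yes p = app (fromℕ< p) (λ i → decodeT k fuel (nth (Fin.toℕ i) r))
  ...   | no _  = var Fin.zero

  decodePair : (k : ℕ) → ℕ → Term (suc k) × Term (suc k)
  decodePair k n = decodeT k (suc (proj₁ (unpair n))) (proj₁ (unpair n))
                 , decodeT k (suc (proj₂ (unpair n))) (proj₂ (unpair n))

  -- a law code n = pair m c denotes the equation decodePair m c over X_{m+1}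
  lawVars : ℕ → ℕ
  lawVars n = proj₁ (unpair n)

  lawEq : (n : ℕ) → Term (suc (lawVars n)) × Term (suc (lawVars n))
  lawEq n = decodePair (lawVars n) (proj₂ (unpair n))

  -- The smallest congruence on T(X_{k+1}) containing W_e (decoded) and all
  -- instances of the laws of V: the equality of ⟨ X_{k+1} ∣ W_e ⟩_V.
  data Cg (k e : ℕ) : Term (suc k) → Term (suc k) → Set where
    cg-rel   : ∀ n → n ∈W e →
               Cg k e (proj₁ (decodePair k n)) (proj₂ (decodePair k n))
    cg-law   : ∀ n → n ∈W lawIdx → (σ : Fin (suc (lawVars n)) → Term (suc k)) →
               Cg k e (substT σ (proj₁ (lawEq n))) (substT σ (proj₂ (lawEq n)))
    cg-refl  : ∀ {t} → Cg k e t t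
    cg-sym   : ∀ {t u} → Cg k e t u → Cg k e u t
    cg-trans : ∀ {t u v} → Cg k e t u → Cg k e u v → Cg k e t v
    cg-cong  : ∀ s {ts us} → (∀ i → Cg k e (ts i) (us i)) →
               Cg k e (app s ts) (app s us)

  -- The algebra V_fg[⟨k+1,e⟩] is the setoid-algebra (Term (suc k), Cg k e).
  -- Code convention: x codes ⟨k+1, e⟩ where unpair x = (k , e).
  gens : ℕ → ℕ
  gens x = proj₁ (unpair x)

  idx : ℕ → ℕ
  idx x = proj₂ (unpair x)

  Carrier : ℕ → Set
  Carrier x = Term (suc (gens x))

  Eq : (x : ℕ) → Carrier x → Carrier x → Set
  Eq x = Cg (gens x) (idx x)

  record IsCongruence (x : ℕ) (θ : Carrier x → Carrier x → Set) : Set where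
    field
      θ-⊇      : ∀ {t u} → Eq x t u → θ t u
      θ-refl   : ∀ {t} → θ t t
      θ-sym    : ∀ {t u} → θ t u → θ u t
      θ-trans  : ∀ {t u v} → θ t u → θ u v → θ t v
      θ-compat : ∀ s {ts us} → (∀ i → θ (ts i) (us i)) → θ (app s ts) (app s us)

  ACC : Set₁
  ACC = ∀ (x : ℕ) (θ : ℕ → Carrier x → Carrier x → Set) →
        (∀ n → IsCongruence x (θ n)) →
        (∀ n {t u} → θ n t u → θ (suc n) t u) →
        ∃ λ N → ∀ n → N ≤ n → ∀ {t u} → θ n t u → θ N t u

  record Iso (x y : ℕ) : Set where
    field
      to      : Carrier x → Carrier y
      from    : Carrier y → Carrier x
      to-resp   : ∀ {t u} → Eq x t u → Eq y (to t) (to u)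
      from-resp : ∀ {t u} → Eq y t u → Eq x (from t) (from u)
      to-hom  : ∀ s (ts : Fin (arity s) → Carrier x) →
                Eq y (to (app s ts)) (app s (λ i → to (ts i)))
      from-to : ∀ t → Eq x (from (to t)) t
      to-from : ∀ t → Eq y (to (from t)) t

  _≅fg_ : ℕ → ℕ → Set
  x ≅fg y = Iso x y

{-# OPTIONS --safe #-}

-- To an algebra A = ⟨X_k | W_e⟩_V attach the c.e. set of all pairs (x′, s) such that some generating
-- tuple of A satisfies the relations of the algebra coded by x′ that are enumerated before stage s.
-- This set is an isomorphism invariant. Conversely, ACC for congruences of the free algebra on X_k
-- shows that A is already presented, modulo the laws, by the relations enumerated before some stage N;
-- so if A and B have the same invariant then B is a quotient of A, and A is a quotient of B. By ACC the
-- surjective endomorphism A → B → A is injective (A is Hopfian), hence A → B is an isomorphism.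
-- The reduction is computable because evaluation, substitution and equality in A are jointly given
-- by one inductive Σ₁ rule, whose finite derivations are coded by numbers and checked primitively
-- recursively.
module Submission where

open import Defs
open import Data.Fin using (Fin; zero; suc; toℕ; fromℕ<; fromℕ; _↑ˡ_)
open import Data.Fin.Properties using (toℕ-fromℕ<; toℕ<n; toℕ-injective)
open import Data.Nat
open import Data.Nat.DivMod using (m%n<n; _/_; _%_; m≡m%n+[m/n]*n; [m+kn]%n≡m%n; m<n⇒m%n≡m)
open import Data.Nat.Properties
open import Data.Product hiding (map)
open import Data.Sum using (_⊎_; inj₁; inj₂; [_,_]′)
import Data.Sum as Sum
open import Data.Unit using (⊤; tt)
open import Data.Vec using (Vec; []; _∷_; lookup)
open import Function using (_∘_; id; const)
open import Function.Bundles using (_⇔_; mk⇔; Equivalence)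
open import Relation.Binary.Definitions using (tri<; tri≈; tri>)
open import Relation.Binary.PropositionalEquality
open import Relation.Nullary using (¬_; yes; no; contradiction)

open Equivalence using (to; from)

-- Pairing and tuples

-- The stage s is what makes the invariant c.e. That a tuple satisfies every relation in a c.e. set
-- is a universal statement about an enumeration; for the relations found before s it is a bounded
-- conjunction of Σ₁ conditions: either d enumerates nothing, which is decidable, or its relation is
-- derivable. The decisive stage N of an algebra is never computed from its index. The invariant
-- lists all stages, and N enters only the proof that equal invariants give isomorphic algebras.
-- Equality in A cannot be enumerated by itself: relations and laws are members of c.e. sets, which
-- calls for evaluation, and instances of laws call for substitution. Since facts of all three kinds
-- are derived by one rule, the rule also serves as the universal machine, and one search for
-- certificates replaces an interpreter written in `Code`.

π₁ π₂ : ℕ → ℕ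
π₁ n = proj₁ (unpair n)
π₂ n = proj₂ (unpair n)

pair-sucˡ : ∀ a b → pair (suc a) b ≡ suc (pair a (suc b))
pair-sucˡ a b rewrite +-suc a b = +-suc (tri (suc (a + b))) a

pair-zeroˡ : ∀ b → pair 0 (suc b) ≡ suc (pair b 0)
pair-zeroˡ b rewrite +-identityʳ (b + tri b) | +-identityʳ b = cong suc (+-comm b (tri b))

nextPair : ℕ × ℕ → ℕ × ℕ
nextPair (a , zero)  = 0 , suc a
nextPair (a , suc b) = suc a , b

unpair-suc : ∀ n → unpair (suc n) ≡ nextPair (unpair n)
unpair-suc n with unpair n
... | a , zero  = refl
... | a , suc b = refl

unpair-next : ∀ {n m a b} → n ≡ suc m → unpair m ≡ (a , b) → unpair n ≡ nextPair (a , b)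
unpair-next {m = m} refl eq = trans (unpair-suc m) (cong nextPair eq)

-- Both functions walk the diagonals in the same order. The induction follows this walk backwards:
-- down in `a` along diagonal d, then from its start to the end of the previous diagonal.
unpair-pair′ : ∀ d a b → a + b ≡ d → unpair (pair a b) ≡ (a , b)
unpair-pair′ zero zero zero _ = refl
unpair-pair′ (suc d) zero (suc b) p =
  unpair-next (pair-zeroˡ b) (unpair-pair′ d b 0 (trans (+-identityʳ b) (suc-injective p)))
unpair-pair′ (suc d) (suc a) b p =
  unpair-next (pair-sucˡ a b) (unpair-pair′ (suc d) a (suc b) (trans (+-suc a b) p))

unpair-pair : ∀ a b → unpair (pair a b) ≡ (a , b)
unpair-pair a b = unpair-pair′ (a + b) a b refl

pair-unpair : ∀ n → pair (π₁ n) (π₂ n) ≡ n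
pair-unpair zero = refl
pair-unpair (suc n) with unpair n | pair-unpair n
... | a , zero  | refl = pair-zeroˡ a
... | a , suc b | refl = pair-sucˡ a b

opaque

  -- A copy of pair that Agda does not unfold, so that its arguments can be inferred.
  ⟪_,_⟫ : ℕ → ℕ → ℕ
  ⟪ a , b ⟫ = pair a b

  unpair-⟪⟫ : ∀ a b → unpair ⟪ a , b ⟫ ≡ (a , b)
  unpair-⟪⟫ = unpair-pair

  pair≡⟪⟫ : ∀ a b → pair a b ≡ ⟪ a , b ⟫
  pair≡⟪⟫ a b = refl

  ⟪⟫-unpair : ∀ n → ⟪ π₁ n , π₂ n ⟫ ≡ n
  ⟪⟫-unpair = pair-unpair

π₁-⟪⟫ : ∀ a b → π₁ ⟪ a , b ⟫ ≡ a
π₁-⟪⟫ a b = cong proj₁ (unpair-⟪⟫ a b)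

π₂-⟪⟫ : ∀ a b → π₂ ⟪ a , b ⟫ ≡ b
π₂-⟪⟫ a b = cong proj₂ (unpair-⟪⟫ a b)

n≤tri : ∀ n → n ≤ tri n
n≤tri zero    = z≤n
n≤tri (suc n) = m≤m+n (suc n) (tri n)

π₁≤ : ∀ n → π₁ n ≤ n
π₁≤ n = subst (π₁ n ≤_) (pair-unpair n) (m≤n+m (π₁ n) (tri (π₁ n + π₂ n)))

-- The summand `π₁ n` is kept because a nonzero tag then makes the remainder strictly smaller than
-- n. All recursions on codes descend for this reason.
π₂+π₁≤ : ∀ n → π₂ n + π₁ n ≤ n
π₂+π₁≤ n = subst (π₂ n + π₁ n ≤_) (pair-unpair n)
  (+-monoˡ-≤ (π₁ n) (≤-trans (m≤n+m (π₂ n) (π₁ n)) (n≤tri (π₁ n + π₂ n))))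

π₂≤ : ∀ n → π₂ n ≤ n
π₂≤ n = ≤-trans (m≤m+n (π₂ n) (π₁ n)) (π₂+π₁≤ n)

nth≤ : ∀ i r → nth i r ≤ r
nth≤ zero    r = π₁≤ r
nth≤ (suc i) r = ≤-trans (nth≤ i (π₂ r)) (π₂≤ r)

π₂<-tagged : ∀ {n t r} → unpair n ≡ (suc t , r) → r < n
π₂<-tagged {n} {t} {r} eq with π₂+π₁≤ n
... | h rewrite eq = ≤-trans (subst (suc r ≤_) (sym (+-suc r t)) (s≤s (m≤m+n r t))) h

nth<-tagged : ∀ {n t r} i → unpair n ≡ (suc t , r) → nth i r < n
nth<-tagged {r = r} i eq = ≤-<-trans (nth≤ i r) (π₂<-tagged eq)

tuple : ∀ n → (Fin n → ℕ) → ℕ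
tuple zero    f = 0
tuple (suc n) f = ⟪ f zero , tuple n (f ∘ suc) ⟫

nth-tuple : ∀ {n} (f : Fin n → ℕ) i → nth (toℕ i) (tuple n f) ≡ f i
nth-tuple {suc n} f zero    = π₁-⟪⟫ (f zero) (tuple n (f ∘ suc))
nth-tuple {suc n} f (suc i) rewrite π₂-⟪⟫ (f zero) (tuple n (f ∘ suc)) = nth-tuple (f ∘ suc) i

nth-tuple-< : ∀ {n} (f : Fin n → ℕ) {j} (p : j < n) → nth j (tuple n f) ≡ f (fromℕ< p)
nth-tuple-< f p = trans (cong (λ j → nth j (tuple _ f)) (sym (toℕ-fromℕ< p))) (nth-tuple f (fromℕ< p))

-- Inversion and determinism of evaluation

Inv : Code → ℕ → ℕ → Set
Inv cZero       x y = y ≡ 0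
Inv cSucc       x y = y ≡ suc x
Inv cId         x y = y ≡ x
Inv cFst        x y = y ≡ π₁ x
Inv cSnd        x y = y ≡ π₂ x
Inv (cComp f g) x y = ∃ λ w → g ⟨ x ⟩⇓ w × f ⟨ w ⟩⇓ y
Inv (cPair f g) x y = f ⟨ x ⟩⇓ π₁ y × g ⟨ x ⟩⇓ π₂ y
Inv (cRec f g)  x y =
  (π₂ x ≡ 0 × f ⟨ π₁ x ⟩⇓ y) ⊎
  (∃ λ n → ∃ λ z → π₂ x ≡ suc n × cRec f g ⟨ ⟪ π₁ x , n ⟫ ⟩⇓ z × g ⟨ ⟪ π₁ x , ⟪ n , z ⟫ ⟫ ⟩⇓ y)
Inv (cMin f)    x y = f ⟨ ⟪ x , y ⟫ ⟩⇓ 0 × (∀ m → m < y → Σ ℕ λ k → f ⟨ ⟪ x , m ⟫ ⟩⇓ suc k)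

opaque
  unfolding ⟪_,_⟫

  inv : ∀ {c x y} → c ⟨ x ⟩⇓ y → Inv c x y
  inv ev-zero = refl
  inv ev-succ = refl
  inv ev-id   = refl
  inv (ev-fst {a} {b}) = sym (π₁-⟪⟫ a b)
  inv (ev-snd {a} {b}) = sym (π₂-⟪⟫ a b)
  inv (ev-comp p q) = _ , p , q
  inv (ev-pair {y = y} {z = z} p q) rewrite π₁-⟪⟫ y z | π₂-⟪⟫ y z = p , q
  inv (ev-rec0 {a = a} p) rewrite π₁-⟪⟫ a 0 | π₂-⟪⟫ a 0 = inj₁ (refl , p)
  inv (ev-recS {a = a} {n = n} {z = z} p q)
    rewrite π₁-⟪⟫ a (suc n) | π₂-⟪⟫ a (suc n) = inj₂ (n , z , refl , p , q)
  inv (ev-min p q) = p , q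

  unInv : ∀ c {x y} → Inv c x y → c ⟨ x ⟩⇓ y
  unInv cZero refl = ev-zero
  unInv cSucc refl = ev-succ
  unInv cId   refl = ev-id
  unInv cFst {x} refl = subst (λ u → cFst ⟨ u ⟩⇓ π₁ x) (⟪⟫-unpair x) (ev-fst {π₁ x} {π₂ x})
  unInv cSnd {x} refl = subst (λ u → cSnd ⟨ u ⟩⇓ π₂ x) (⟪⟫-unpair x) (ev-snd {π₁ x} {π₂ x})
  unInv (cComp f g) (w , p , q) = ev-comp p q
  unInv (cPair f g) {x} {y} (p , q) = subst (cPair f g ⟨ x ⟩⇓_) (⟪⟫-unpair y) (ev-pair p q)
  unInv (cRec f g) {x} {y} (inj₁ (e , p)) =
    subst (λ u → cRec f g ⟨ u ⟩⇓ y) (trans (cong (⟪ π₁ x ,_⟫) (sym e)) (⟪⟫-unpair x)) (ev-rec0 {a = π₁ x} p)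
  unInv (cRec f g) {x} {y} (inj₂ (n , z , e , p , q)) =
    subst (λ u → cRec f g ⟨ u ⟩⇓ y) (trans (cong (⟪ π₁ x ,_⟫) (sym e)) (⟪⟫-unpair x))
      (ev-recS {a = π₁ x} {n = n} p q)
  unInv (cMin f) (p , q) = ev-min p q

  ⇓-det : ∀ {c x y z} → c ⟨ x ⟩⇓ y → c ⟨ x ⟩⇓ z → y ≡ z
  ⇓-det ev-zero q = sym (inv q)
  ⇓-det ev-succ q = sym (inv q)
  ⇓-det ev-id   q = sym (inv q)
  ⇓-det (ev-fst {a} {b}) q = trans (sym (π₁-⟪⟫ a b)) (sym (inv q))
  ⇓-det (ev-snd {a} {b}) q = trans (sym (π₂-⟪⟫ a b)) (sym (inv q))
  ⇓-det (ev-comp p₁ p₂) q with inv q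
  ... | _ , q₁ , q₂ with refl ← ⇓-det p₁ q₁ = ⇓-det p₂ q₂
  ⇓-det {z = z} (ev-pair p₁ p₂) q with inv q
  ... | q₁ , q₂ = trans (cong₂ ⟪_,_⟫ (⇓-det p₁ q₁) (⇓-det p₂ q₂)) (⟪⟫-unpair z)
  ⇓-det (ev-rec0 {a = a} p) q with inv q
  ... | r rewrite π₁-⟪⟫ a 0 | π₂-⟪⟫ a 0 with r
  ... | inj₁ (_ , q₁) = ⇓-det p q₁
  ⇓-det (ev-recS {a = a} {n = n} p₁ p₂) q with inv q
  ... | r rewrite π₁-⟪⟫ a (suc n) | π₂-⟪⟫ a (suc n) with r
  ... | inj₂ (_ , _ , refl , q₁ , q₂) with refl ← ⇓-det p₁ q₁ = ⇓-det p₂ q₂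
  ⇓-det (ev-min {n = n} p₁ p₂) q with inv q
  ⇓-det {z = z} (ev-min {n = n} p₁ p₂) q | q₁ , q₂ with <-cmp n z
  ... | tri≈ _ n≡z _ = n≡z
  -- The smaller of two results would be a zero at which the other search has already met a
  -- successor.
  ... | tri< n<z _ _ = contradiction (⇓-det p₁ (proj₂ (q₂ n n<z))) λ ()
  ... | tri> _ _ z<n = contradiction (⇓-det (proj₂ (p₂ z z<n)) q₁) λ ()

  ev-⟪⟫ : ∀ {f g x y z} → f ⟨ x ⟩⇓ y → g ⟨ x ⟩⇓ z → cPair f g ⟨ x ⟩⇓ ⟪ y , z ⟫
  ev-⟪⟫ = ev-pair

  ev-rec0-⟪⟫ : ∀ {f g a y} → f ⟨ a ⟩⇓ y → cRec f g ⟨ ⟪ a , 0 ⟫ ⟩⇓ y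
  ev-rec0-⟪⟫ {a = a} = ev-rec0 {a = a}

  ev-recS-⟪⟫ : ∀ {f g a n z y} → cRec f g ⟨ ⟪ a , n ⟫ ⟩⇓ z → g ⟨ ⟪ a , ⟪ n , z ⟫ ⟫ ⟩⇓ y →
               cRec f g ⟨ ⟪ a , suc n ⟫ ⟩⇓ y
  ev-recS-⟪⟫ {a = a} {n = n} = ev-recS {a = a} {n = n}

-- Computable functions on encoded domains

-- Codes act on single numbers; `enc` lets functions of several arguments, of environments and of
-- recursion states be composed without writing out their codes.
Computes : {A : Set} → (A → ℕ) → (A → ℕ) → Set
Computes enc f = Σ Code λ c → ∀ a → c ⟨ enc a ⟩⇓ f a

module _ {A : Set} {enc : A → ℕ} where

  compose : ∀ {B : Set} {encB : B → ℕ} {g : A → B} {f : B → ℕ} →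
            Computes encB f → Computes enc (encB ∘ g) → Computes enc (f ∘ g)
  compose (c , p) (d , q) = cComp c d , λ a → ev-comp (q a) (p _)

  pairing : ∀ {f g : A → ℕ} → Computes enc f → Computes enc g → Computes enc (λ a → ⟪ f a , g a ⟫)
  pairing (c , p) (d , q) = cPair c d , λ a → ev-⟪⟫ (p a) (q a)

  identity : Computes enc enc
  identity = cId , λ a → ev-id

  successor : ∀ {f : A → ℕ} → Computes enc f → Computes enc (suc ∘ f)
  successor (c , p) = cComp cSucc c , λ a → ev-comp (p a) ev-succ

  constant : ∀ n → Computes enc (λ _ → n)
  constant zero    = cZero , λ a → ev-zero
  constant (suc n) = successor (constant n)

fstC : ∀ {A : Set} {f g : A → ℕ} → Computes (λ a → ⟪ f a , g a ⟫) f
fstC {f = f} {g} = cFst , λ a → unInv cFst (sym (π₁-⟪⟫ (f a) (g a)))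

sndC : ∀ {A : Set} {f g : A → ℕ} → Computes (λ a → ⟪ f a , g a ⟫) g
sndC {f = f} {g} = cSnd , λ a → unInv cSnd (sym (π₂-⟪⟫ (f a) (g a)))

π₁C : Computable π₁
π₁C = cFst , λ x → unInv cFst refl

π₂C : Computable π₂
π₂C = cSnd , λ x → unInv cSnd refl

natRec : ℕ → (ℕ → ℕ → ℕ) → ℕ → ℕ
natRec b s zero    = b
natRec b s (suc n) = s n (natRec b s n)

recursion : ∀ {A : Set} {enc : A → ℕ} {b : A → ℕ} {s : A → ℕ → ℕ → ℕ} {m : A → ℕ} →
            Computes enc b →
            Computes {A × ℕ × ℕ} (λ (a , n , z) → ⟪ enc a , ⟪ n , z ⟫ ⟫) (λ (a , n , z) → s a n z) →
            Computes enc m →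
            Computes enc (λ a → natRec (b a) (s a) (m a))
recursion {A} {enc} {b} {s} {m} (cb , pb) (cs , ps) (cm , pm) =
  cComp (cRec cb cs) (cPair cId cm) , λ a → ev-comp (ev-⟪⟫ ev-id (pm a)) (loop a (m a))
  where
  loop : ∀ a n → cRec cb cs ⟨ ⟪ enc a , n ⟫ ⟩⇓ natRec (b a) (s a) n
  loop a zero    = ev-rec0-⟪⟫ (pb a)
  loop a (suc n) = ev-recS-⟪⟫ (loop a n) (ps (a , n , _))

Computes₂ : (ℕ → ℕ → ℕ) → Set
Computes₂ f = Computes {ℕ × ℕ} (λ (m , n) → ⟪ m , n ⟫) (λ (m , n) → f m n)

apply₂ : ∀ {A : Set} {enc f g : A → ℕ} {h} → Computes₂ h → Computes enc f → Computes enc g →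
         Computes enc (λ a → h (f a) (g a))
apply₂ {f = f} {g} H F G = compose {g = λ a → f a , g a} H (pairing F G)

≗-computes : ∀ {A : Set} {enc f g : A → ℕ} → (∀ a → f a ≡ g a) → Computes enc f → Computes enc g
≗-computes eq (c , p) = c , λ a → subst (c ⟨ _ ⟩⇓_) (eq a) (p a)

module _ {A : Set} {enc : A → ℕ} where

  private
    Step = Computes {A × ℕ × ℕ} (λ (a , n , z) → ⟪ enc a , ⟪ n , z ⟫ ⟫)

  argC : Step (λ (a , _) → enc a)
  argC = fstC

  counterC : Step (λ (_ , n , _) → n)
  counterC = compose {g = λ (_ , n , z) → n , z} fstC sndC

  accC : Step (λ (_ , _ , z) → z)
  accC = compose {g = λ (_ , n , z) → n , z} sndC sndC

-- Primitive recursive arithmetic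

pairC : Computes₂ ⟪_,_⟫
pairC = identity

iter-suc : ∀ m n → natRec m (λ _ → suc) n ≡ n + m
iter-suc m zero    = refl
iter-suc m (suc n) = cong suc (iter-suc m n)

plusC : Computes₂ _+_
plusC = ≗-computes (λ (m , n) → iter-suc n m)
  (recursion {s = λ _ _ → suc} sndC (successor accC) fstC)

iter-plus : ∀ m n → natRec 0 (λ _ z → m + z) n ≡ n * m
iter-plus m zero    = refl
iter-plus m (suc n) = cong (m +_) (iter-plus m n)

timesC : Computes₂ _*_
timesC = ≗-computes (λ (m , n) → iter-plus n m)
  (recursion {s = λ (_ , n) _ z → n + z} (constant 0)
    (apply₂ plusC (compose {g = proj₁} sndC argC) accC) fstC)

rec-pred : ∀ n → natRec 0 (λ i _ → i) n ≡ pred n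
rec-pred zero    = refl
rec-pred (suc n) = refl

predC : Computable pred
predC = ≗-computes rec-pred (recursion {s = λ _ i _ → i} (constant 0) counterC identity)

iter-pred : ∀ m n → natRec m (λ _ → pred) n ≡ m ∸ n
iter-pred m zero    = refl
iter-pred m (suc n) rewrite iter-pred m n = pred[m∸n]≡m∸[1+n] m n

monusC : Computes₂ _∸_
monusC = ≗-computes (λ (m , n) → iter-pred m n)
  (recursion {s = λ _ _ → pred} fstC (compose predC accC) sndC)

iter-π₂ : ∀ i r → π₁ (natRec r (λ _ → π₂) i) ≡ nth i r
iter-π₂ zero    r = refl
iter-π₂ (suc i) r = trans (cong π₁ (shift i)) (iter-π₂ i (π₂ r))
  where
  shift : ∀ i → π₂ (natRec r (λ _ → π₂) i) ≡ natRec (π₂ r) (λ _ → π₂) i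
  shift zero    = refl
  shift (suc i) = cong π₂ (shift i)

nthC : Computes₂ nth
nthC = ≗-computes (λ (i , r) → iter-π₂ i r)
  (compose π₁C (recursion {s = λ _ _ → π₂} sndC (compose π₂C accC) fstC))

-- With 0 read as true, these are the bounded universal and the bounded existential quantifier.
sumTo prodTo : ℕ → (ℕ → ℕ) → ℕ
sumTo  n f = natRec 0 (λ i z → f i + z) n
prodTo n f = natRec 1 (λ i z → f i * z) n

module _ {A : Set} {enc : A → ℕ} {m : A → ℕ} {f : ℕ → A → ℕ}
         (M : Computes enc m)
         (F : Computes {ℕ × A} (λ (i , a) → ⟪ i , enc a ⟫) (λ (i , a) → f i a)) where

  private
    body : Computes {A × ℕ × ℕ} (λ (a , n , z) → ⟪ enc a , ⟪ n , z ⟫ ⟫) (λ (a , n , _) → f n a)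
    body = compose {g = λ (a , n , _) → n , a} F (pairing counterC argC)

  sumC : Computes enc (λ a → sumTo (m a) (λ i → f i a))
  sumC = recursion {s = λ a i z → f i a + z} (constant 0) (apply₂ plusC body accC) M

  prodC : Computes enc (λ a → prodTo (m a) (λ i → f i a))
  prodC = recursion {s = λ a i z → f i a * z} (constant 1) (apply₂ timesC body accC) M

sumTo≡0 : ∀ n {f} → sumTo n f ≡ 0 ⇔ (∀ i → i < n → f i ≡ 0)
sumTo≡0 n = mk⇔ (fwd n) (bwd n)
  where
  fwd : ∀ n {f} → sumTo n f ≡ 0 → ∀ i → i < n → f i ≡ 0
  fwd (suc n) {f} eq i i<1+n with m≤n⇒m<n∨m≡n (s≤s⁻¹ i<1+n)
  ... | inj₁ i<n  = fwd n (m+n≡0⇒n≡0 (f n) eq) i i<n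
  ... | inj₂ refl = m+n≡0⇒m≡0 (f n) eq
  bwd : ∀ n {f} → (∀ i → i < n → f i ≡ 0) → sumTo n f ≡ 0
  bwd zero    h = refl
  bwd (suc n) h = cong₂ _+_ (h n ≤-refl) (bwd n λ i p → h i (m≤n⇒m≤1+n p))

prodTo≡0 : ∀ n {f} → prodTo n f ≡ 0 ⇔ (∃ λ i → i < n × f i ≡ 0)
prodTo≡0 n = mk⇔ (fwd n) (bwd n)
  where
  fwd : ∀ n {f} → prodTo n f ≡ 0 → ∃ λ i → i < n × f i ≡ 0
  fwd (suc n) {f} eq with m*n≡0⇒m≡0∨n≡0 (f n) eq
  ... | inj₁ p = n , ≤-refl , p
  ... | inj₂ p with fwd n p
  ... | i , i<n , q = i , m≤n⇒m≤1+n i<n , q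
  bwd : ∀ n {f} → (∃ λ i → i < n × f i ≡ 0) → prodTo n f ≡ 0
  bwd (suc n) {f} (i , i<1+n , q) with m≤n⇒m<n∨m≡n (s≤s⁻¹ i<1+n)
  ... | inj₁ i<n  = trans (cong (f n *_) (bwd n {f} (i , i<n , q))) (*-zeroʳ (f n))
  ... | inj₂ refl rewrite q = refl

dist : ℕ → ℕ → ℕ
dist m n = (m ∸ n) + (n ∸ m)

dist≡0 : ∀ m n → dist m n ≡ 0 ⇔ m ≡ n
dist≡0 m n = mk⇔
  (λ eq → ≤-antisym (m∸n≡0⇒m≤n (m+n≡0⇒m≡0 (m ∸ n) eq)) (m∸n≡0⇒m≤n (m+n≡0⇒n≡0 (m ∸ n) eq)))
  (λ { refl → cong₂ _+_ (n∸n≡0 m) (n∸n≡0 m) })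

distC : ∀ {A : Set} {enc f g : A → ℕ} → Computes enc f → Computes enc g →
        Computes enc (λ a → dist (f a) (g a))
distC F G = apply₂ plusC (apply₂ monusC F G) (apply₂ monusC G F)

-- Gödel numbers and the s-m-n theorem

-- One unfolding of `decodeC` with the recursive calls abstracted into `F`. Independence of the fuel
-- and the recursion equation `φ-shape` then both follow from `shape-cong`.
shape : (ℕ → Code) → ℕ → ℕ → Code
shape F 0 r = cZero
shape F 1 r = cSucc
shape F 2 r = cId
shape F 3 r = cFst
shape F 4 r = cSnd
shape F 5 r = cComp (F (nth 0 r)) (F (nth 1 r))
shape F 6 r = cPair (F (nth 0 r)) (F (nth 1 r))
shape F 7 r = cRec (F (nth 0 r)) (F (nth 1 r))
shape F 8 r = cMin (F r)
shape F _ r = cZero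

decodeC-shape : ∀ f n → decodeC (suc f) n ≡ shape (decodeC f) (π₁ n) (π₂ n)
decodeC-shape f n with unpair n
... | 0 , r = refl
... | 1 , r = refl
... | 2 , r = refl
... | 3 , r = refl
... | 4 , r = refl
... | 5 , r = refl
... | 6 , r = refl
... | 7 , r = refl
... | 8 , r = refl
... | suc (suc (suc (suc (suc (suc (suc (suc (suc _)))))))) , r = refl

shape-cong : ∀ {F G} n → (∀ m → m < n → F m ≡ G m) → shape F (π₁ n) (π₂ n) ≡ shape G (π₁ n) (π₂ n)
shape-cong n h with unpair n in eq
... | 0 , r = refl
... | 1 , r = refl
... | 2 , r = refl
... | 3 , r = refl
... | 4 , r = refl
... | 5 , r = cong₂ cComp (h _ (nth<-tagged 0 eq)) (h _ (nth<-tagged 1 eq))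
... | 6 , r = cong₂ cPair (h _ (nth<-tagged 0 eq)) (h _ (nth<-tagged 1 eq))
... | 7 , r = cong₂ cRec  (h _ (nth<-tagged 0 eq)) (h _ (nth<-tagged 1 eq))
... | 8 , r = cong cMin (h _ (π₂<-tagged eq))
... | suc (suc (suc (suc (suc (suc (suc (suc (suc _)))))))) , r = refl

decodeC-fuel : ∀ f g n → n < f → n < g → decodeC f n ≡ decodeC g n
decodeC-fuel (suc f) (suc g) n n<f n<g =
  trans (decodeC-shape f n) (trans
    (shape-cong n λ m m<n →
      decodeC-fuel f g m (<-≤-trans m<n (s≤s⁻¹ n<f)) (<-≤-trans m<n (s≤s⁻¹ n<g)))
    (sym (decodeC-shape g n)))

φ-shape : ∀ e → φ e ≡ shape φ (π₁ e) (π₂ e)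
φ-shape e = trans (decodeC-shape e e)
  (shape-cong e λ m m<e → decodeC-fuel e (suc m) m m<e ≤-refl)

-- The trailing 0 pads the list of subcodes: `nth 1` expects the second one as the first component
-- of a further pair.
⌊_⌋ : Code → ℕ
⌊ cZero ⌋     = ⟪ 0 , 0 ⟫
⌊ cSucc ⌋     = ⟪ 1 , 0 ⟫
⌊ cId ⌋       = ⟪ 2 , 0 ⟫
⌊ cFst ⌋      = ⟪ 3 , 0 ⟫
⌊ cSnd ⌋      = ⟪ 4 , 0 ⟫
⌊ cComp f g ⌋ = ⟪ 5 , ⟪ ⌊ f ⌋ , ⟪ ⌊ g ⌋ , 0 ⟫ ⟫ ⟫
⌊ cPair f g ⌋ = ⟪ 6 , ⟪ ⌊ f ⌋ , ⟪ ⌊ g ⌋ , 0 ⟫ ⟫ ⟫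
⌊ cRec f g ⌋  = ⟪ 7 , ⟪ ⌊ f ⌋ , ⟪ ⌊ g ⌋ , 0 ⟫ ⟫ ⟫
⌊ cMin f ⌋    = ⟪ 8 , ⌊ f ⌋ ⟫

φ-tagged : ∀ t r → φ ⟪ t , r ⟫ ≡ shape φ t r
φ-tagged t r = trans (φ-shape ⟪ t , r ⟫) (cong₂ (shape φ) (π₁-⟪⟫ t r) (π₂-⟪⟫ t r))

nth₀ : ∀ a b → nth 0 ⟪ a , ⟪ b , 0 ⟫ ⟫ ≡ a
nth₀ a b = π₁-⟪⟫ a ⟪ b , 0 ⟫

nth₁ : ∀ a b → nth 1 ⟪ a , ⟪ b , 0 ⟫ ⟫ ≡ b
nth₁ a b = trans (cong π₁ (π₂-⟪⟫ a ⟪ b , 0 ⟫)) (π₁-⟪⟫ b 0)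

φ-⌊⌋ : ∀ c → φ ⌊ c ⌋ ≡ c
φ-⌊⌋-both : ∀ (k : Code → Code → Code) f g →
  k (φ (nth 0 ⟪ ⌊ f ⌋ , ⟪ ⌊ g ⌋ , 0 ⟫ ⟫)) (φ (nth 1 ⟪ ⌊ f ⌋ , ⟪ ⌊ g ⌋ , 0 ⟫ ⟫)) ≡ k f g

φ-⌊⌋ cZero       = φ-tagged 0 0
φ-⌊⌋ cSucc       = φ-tagged 1 0
φ-⌊⌋ cId         = φ-tagged 2 0
φ-⌊⌋ cFst        = φ-tagged 3 0
φ-⌊⌋ cSnd        = φ-tagged 4 0
φ-⌊⌋ (cComp f g) = trans (φ-tagged 5 _) (φ-⌊⌋-both cComp f g)
φ-⌊⌋ (cPair f g) = trans (φ-tagged 6 _) (φ-⌊⌋-both cPair f g)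
φ-⌊⌋ (cRec f g)  = trans (φ-tagged 7 _) (φ-⌊⌋-both cRec f g)
φ-⌊⌋ (cMin f)    = trans (φ-tagged 8 _) (cong cMin (φ-⌊⌋ f))

φ-⌊⌋-both k f g = cong₂ k (trans (cong φ (nth₀ ⌊ f ⌋ ⌊ g ⌋)) (φ-⌊⌋ f)) (trans (cong φ (nth₁ ⌊ f ⌋ ⌊ g ⌋)) (φ-⌊⌋ g))

∈W-⌊⌋ : ∀ c z → z ∈W ⌊ c ⌋ ⇔ (∃ λ y → c ⟨ z ⟩⇓ y)
∈W-⌊⌋ c z = mk⇔ (map₂ (subst (_⟨ z ⟩⇓ _) (φ-⌊⌋ c))) (map₂ (subst (_⟨ z ⟩⇓ _) (sym (φ-⌊⌋ c))))

numeral : ℕ → Code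
numeral n = proj₁ (constant {enc = id} n)

numeral-⇓ : ∀ n z → numeral n ⟨ z ⟩⇓ n
numeral-⇓ n = proj₂ (constant n)

⌊comp⌋C : ∀ {A : Set} {enc f g : A → ℕ} t → Computes enc f → Computes enc g →
          Computes enc (λ a → ⟪ t , ⟪ f a , ⟪ g a , 0 ⟫ ⟫ ⟫)
⌊comp⌋C t F G = pairing (constant t) (pairing F (pairing G (constant 0)))

⌊numeral⌋C : Computable (λ n → ⌊ numeral n ⌋)
⌊numeral⌋C = ≗-computes rec-numeral
  (recursion {s = λ _ _ z → ⟪ 5 , ⟪ ⌊ cSucc ⌋ , ⟪ z , 0 ⟫ ⟫ ⟫} (constant ⌊ cZero ⌋)
    (⌊comp⌋C 5 (constant ⌊ cSucc ⌋) accC) identity)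
  where
  rec-numeral : ∀ n → natRec ⌊ cZero ⌋ (λ _ z → ⟪ 5 , ⟪ ⌊ cSucc ⌋ , ⟪ z , 0 ⟫ ⟫ ⟫) n ≡ ⌊ numeral n ⌋
  rec-numeral zero    = refl
  rec-numeral (suc n) = cong (λ z → ⟪ 5 , ⟪ ⌊ cSucc ⌋ , ⟪ z , 0 ⟫ ⟫ ⟫) (rec-numeral n)

s-m-n : ∀ U → Σ (ℕ → ℕ) λ h → Computable h × (∀ x z → z ∈W h x ⇔ (∃ λ y → U ⟨ ⟪ x , z ⟫ ⟩⇓ y))
s-m-n U = (λ x → ⌊ section x ⌋) ,
  -- This is the Gödel number of `section x` spelled out; only its part `⌊ numeral x ⌋` varies with
  -- x.
  ⌊comp⌋C 5 (constant ⌊ U ⌋) (⌊comp⌋C 6 ⌊numeral⌋C (constant ⌊ cId ⌋)) ,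
  λ x z → mk⇔
    (λ h → sound x z (Equivalence.to (∈W-⌊⌋ (section x) z) h))
    (λ (y , h) → Equivalence.from (∈W-⌊⌋ (section x) z)
      (y , ev-comp (ev-⟪⟫ (numeral-⇓ x z) ev-id) h))
  where
  section : ℕ → Code
  section x = cComp U (cPair (numeral x) cId)
  sound : ∀ x z → (∃ λ y → section x ⟨ z ⟩⇓ y) → ∃ λ y → U ⟨ ⟪ x , z ⟫ ⟩⇓ y
  sound x z (y , h) with inv h
  ... | w , p , q with ⇓-det p (ev-⟪⟫ (numeral-⇓ x z) ev-id)
  ... | refl = y , q

-- A search for a zero of the constant function 1. Its index presents free algebras, having no
-- relations.
diverge : Code
diverge = cMin (cComp cSucc cZero)

diverge-⇑ : ∀ {x y} → ¬ diverge ⟨ x ⟩⇓ y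
diverge-⇑ h with inv (proj₁ (inv h))
... | w , _ , q with () ← inv q

-- Σ₁ formulas over an inductively defined predicate

⌜_⌝ : ∀ {n} → Vec ℕ n → ℕ
⌜ [] ⌝    = 0
⌜ x ∷ ρ ⌝ = ⟪ x , ⌜ ρ ⌝ ⟫

data Exp (n : ℕ) : Set where
  var : Fin n → Exp n
  lit : ℕ → Exp n
  op₁ : (f : ℕ → ℕ) → Computable f → Exp n → Exp n
  op₂ : (f : ℕ → ℕ → ℕ) → Computes₂ f → Exp n → Exp n → Exp n

⟦_⟧ₑ : ∀ {n} → Exp n → Vec ℕ n → ℕ
⟦ var i ⟧ₑ       ρ = lookup ρ i
⟦ lit m ⟧ₑ       ρ = m
⟦ op₁ f _ a ⟧ₑ   ρ = f (⟦ a ⟧ₑ ρ)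
⟦ op₂ f _ a b ⟧ₑ ρ = f (⟦ a ⟧ₑ ρ) (⟦ b ⟧ₑ ρ)

expC : ∀ {n} (e : Exp n) → Computes ⌜_⌝ ⟦ e ⟧ₑ
expC (var i) = lookupC i
  where
  lookupC : ∀ {n} (i : Fin n) → Computes ⌜_⌝ (λ ρ → lookup ρ i)
  lookupC zero    = cFst , λ { (x ∷ ρ) → proj₂ (fstC {f = proj₁} {g = proj₂}) (x , ⌜ ρ ⌝) }
  lookupC (suc i) = cComp (proj₁ (lookupC i)) cSnd ,
    λ { (x ∷ ρ) → ev-comp (proj₂ (sndC {f = proj₁} {g = proj₂}) (x , ⌜ ρ ⌝)) (proj₂ (lookupC i) ρ) }
expC (lit m) = constant m
expC (op₁ f F a) = compose F (expC a)
expC (op₂ f F a b) = apply₂ F (expC a) (expC b)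

infix  6 _==_ _<<_ _=/=_
infixr 5 _∧_
infixr 4 _∨_

data Fm (n : ℕ) : Set where
  _==_ _=/=_ _<<_ : Exp n → Exp n → Fm n
  _∧_ _∨_   : Fm n → Fm n → Fm n
  all<      : Exp n → Fm (suc n) → Fm n
  ex        : Fm (suc n) → Fm n
  mem       : Exp n → Fm n

-- The parameters `D` (admissible witnesses) and `M` (available facts) allow several readings:
-- bounded by a certificate, with all derivable facts, or with all true facts. Negation applies only
-- to equations between computed numbers, so formulas are positive in both parameters, which is what
-- `mono` uses to pass between the readings.
⟦_⟧ : ∀ {n} → Fm n → (D M : ℕ → Set) → Vec ℕ n → Set
⟦ a == b ⟧   D M ρ = ⟦ a ⟧ₑ ρ ≡ ⟦ b ⟧ₑ ρ
⟦ a =/= b ⟧  D M ρ = ¬ ⟦ a ⟧ₑ ρ ≡ ⟦ b ⟧ₑ ρ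
⟦ a << b ⟧   D M ρ = ⟦ a ⟧ₑ ρ < ⟦ b ⟧ₑ ρ
⟦ φ ∧ ψ ⟧    D M ρ = ⟦ φ ⟧ D M ρ × ⟦ ψ ⟧ D M ρ
⟦ φ ∨ ψ ⟧    D M ρ = ⟦ φ ⟧ D M ρ ⊎ ⟦ ψ ⟧ D M ρ
⟦ all< b φ ⟧ D M ρ = ∀ i → i < ⟦ b ⟧ₑ ρ → ⟦ φ ⟧ D M (i ∷ ρ)
⟦ ex φ ⟧     D M ρ = ∃ λ w → D w × ⟦ φ ⟧ D M (w ∷ ρ)
⟦ mem a ⟧    D M ρ = M (⟦ a ⟧ₑ ρ)

mono : ∀ {n} (φ : Fm n) {D D′ M M′ : ℕ → Set} →
       (∀ {w} → D w → D′ w) → (∀ {u} → M u → M′ u) →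
       ∀ {ρ} → ⟦ φ ⟧ D M ρ → ⟦ φ ⟧ D′ M′ ρ
mono (a == b)   d m h = h
mono (a =/= b)  d m h = h
mono (a << b)   d m h = h
mono (φ ∧ ψ)    d m (g , h) = mono φ d m g , mono ψ d m h
mono (φ ∨ ψ)    d m = Sum.map (mono φ d m) (mono ψ d m)
mono (all< b φ) d m h i i<b = mono φ d m (h i i<b)
mono (ex φ)     d m (w , p , h) = w , d p , mono φ d m h
mono (mem a)    d m h = m h

-- A certificate ⟪ ℓ , ⟪ r , b ⟫ ⟫ lists the facts nth 0 r, …, nth (ℓ - 1) r;
-- all existential witnesses used to derive them are below b.
len entries bound : ℕ → ℕ
len     c = π₁ c
entries c = π₁ (π₂ c)
bound   c = π₂ (π₂ c)

Dom Mem : ℕ → ℕ → Set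
Dom c w = w < bound c
Mem c u = ∃ λ j → j < len c × nth j (entries c) ≡ u

-- A primitive recursive truth value, 0 being true. It exists because a certificate bounds the
-- witnesses of `ex` and lists the facts that `mem` may find.
value : ∀ {n} → Fm n → ℕ → Vec ℕ n → ℕ
value (a == b)   c ρ = dist (⟦ a ⟧ₑ ρ) (⟦ b ⟧ₑ ρ)
value (a =/= b)  c ρ = 1 ∸ dist (⟦ a ⟧ₑ ρ) (⟦ b ⟧ₑ ρ)
value (a << b)   c ρ = suc (⟦ a ⟧ₑ ρ) ∸ ⟦ b ⟧ₑ ρ
value (φ ∧ ψ)    c ρ = value φ c ρ + value ψ c ρ
value (φ ∨ ψ)    c ρ = value φ c ρ * value ψ c ρ
value (all< b φ) c ρ = sumTo (⟦ b ⟧ₑ ρ) λ i → value φ c (i ∷ ρ)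
value (ex φ)     c ρ = prodTo (bound c) λ w → value φ c (w ∷ ρ)
value (mem a)    c ρ = prodTo (len c) λ j → dist (nth j (entries c)) (⟦ a ⟧ₑ ρ)

value-to   : ∀ {n} (φ : Fm n) {c ρ} → value φ c ρ ≡ 0 → ⟦ φ ⟧ (Dom c) (Mem c) ρ
value-from : ∀ {n} (φ : Fm n) {c ρ} → ⟦ φ ⟧ (Dom c) (Mem c) ρ → value φ c ρ ≡ 0

value-to (a == b) h = to (dist≡0 _ _) h
value-to (a =/= b) {ρ = ρ} h eq rewrite from (dist≡0 (⟦ a ⟧ₑ ρ) (⟦ b ⟧ₑ ρ)) eq with () ← h
value-to (a << b) h = m∸n≡0⇒m≤n h
value-to (φ ∧ ψ) {c} {ρ} h =
  value-to φ (m+n≡0⇒m≡0 _ h) , value-to ψ (m+n≡0⇒n≡0 (value φ c ρ) h)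
value-to (φ ∨ ψ) {c} {ρ} h = Sum.map (value-to φ) (value-to ψ) (m*n≡0⇒m≡0∨n≡0 (value φ c ρ) h)
value-to (all< b φ) h i i<b = value-to φ (to (sumTo≡0 _) h i i<b)
value-to (ex φ) {c} h with to (prodTo≡0 (bound c)) h
... | w , p , q = w , p , value-to φ q
value-to (mem a) {c} h with to (prodTo≡0 (len c)) h
... | j , p , q = j , p , to (dist≡0 _ _) q

value-from (a == b) h = from (dist≡0 _ _) h
value-from (a =/= b) {ρ = ρ} h with dist (⟦ a ⟧ₑ ρ) (⟦ b ⟧ₑ ρ) in eq
... | zero  = contradiction (to (dist≡0 _ _) eq) h
... | suc m = 0∸n≡0 m
value-from (a << b) h = m≤n⇒m∸n≡0 h
value-from (φ ∧ ψ) {c} (g , h) = cong₂ _+_ (value-from φ {c} g) (value-from ψ {c} h)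
value-from (φ ∨ ψ) {c} {ρ} (inj₁ h) = cong (_* value ψ c ρ) (value-from φ {c} h)
value-from (φ ∨ ψ) {c} {ρ} (inj₂ h) = trans (cong (value φ c ρ *_) (value-from ψ {c} h)) (*-zeroʳ (value φ c ρ))
value-from (all< b φ) {c} h = from (sumTo≡0 _) λ i i<b → value-from φ {c} (h i i<b)
value-from (ex φ) {c} {ρ} (w , p , h) =
  from (prodTo≡0 (bound c) {λ w → value φ c (w ∷ ρ)}) (w , p , value-from φ {c} h)
value-from (mem a) {c} {ρ} (j , p , h) =
  from (prodTo≡0 (len c) {λ j → dist (nth j (entries c)) (⟦ a ⟧ₑ ρ)}) (j , p , from (dist≡0 _ _) h)

withCert : ∀ {n} → ℕ × Vec ℕ n → ℕ
withCert (c , ρ) = ⟪ c , ⌜ ρ ⌝ ⟫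

module _ {n : ℕ} where

  certC : Computes (withCert {n}) proj₁
  certC = fstC

  envC : (e : Exp n) → Computes withCert (λ (_ , ρ) → ⟦ e ⟧ₑ ρ)
  envC e = compose {g = proj₂} (expC e) sndC

  bindC : {f : ℕ → Vec ℕ (suc n) → ℕ} → Computes withCert (λ (c , ρ) → f c ρ) →
          Computes {ℕ × ℕ × Vec ℕ n} (λ (i , a) → ⟪ i , withCert a ⟫) (λ (i , c , ρ) → f c (i ∷ ρ))
  bindC F = compose {g = λ (i , c , ρ) → c , i ∷ ρ} F
    (pairing (compose {g = proj₂} fstC sndC) (pairing fstC (compose {g = proj₂} sndC sndC)))

valueC : ∀ {n} (φ : Fm n) → Computes withCert (λ (c , ρ) → value φ c ρ)
valueC (a == b)   = distC (envC a) (envC b)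
valueC (a =/= b)  = apply₂ monusC (constant 1) (distC (envC a) (envC b))
valueC (a << b)   = apply₂ monusC (successor (envC a)) (envC b)
valueC (φ ∧ ψ)    = apply₂ plusC (valueC φ) (valueC ψ)
valueC (φ ∨ ψ)    = apply₂ timesC (valueC φ) (valueC ψ)
valueC (all< b φ) = sumC (envC b) (bindC (valueC φ))
valueC (ex φ)     = prodC (compose π₂C (compose π₂C certC)) (bindC (valueC φ))
valueC (mem a)    = prodC {f = λ j (c , ρ) → dist (nth j (entries c)) (⟦ a ⟧ₑ ρ)} (compose π₁C certC)
  (distC (apply₂ nthC fstC (compose π₁C (compose π₂C (compose {g = proj₂} certC sndC))))
         (compose {g = proj₂} (envC a) sndC))

-- Facts derivable by a Σ₁ rule

module Derivation (rule : Fm 1) where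

  -- Truncation to the first i facts changes the length alone. Validity asks each fact to follow
  -- from those before it, so circular justifications are excluded.
  before : ℕ → ℕ → ℕ
  before i c = ⟪ i , π₂ c ⟫

  len-before : ∀ i c → len (before i c) ≡ i
  len-before i c = π₁-⟪⟫ i (π₂ c)

  rest-before : ∀ i c → π₂ (before i c) ≡ π₂ c
  rest-before i c = π₂-⟪⟫ i (π₂ c)

  fact : ℕ → ℕ → ℕ
  fact i c = nth i (entries c)

  validity : ℕ → ℕ
  validity c = sumTo (len c) λ i → value rule (before i c) (fact i c ∷ [])

  validityC : Computable validity
  validityC = sumC {f = λ i c → value rule (before i c) (fact i c ∷ [])} π₁C
    (compose {g = λ (i , c) → before i c , fact i c ∷ []} (valueC rule)
      (pairing (pairing fstC (compose π₂C sndC))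
        (pairing (apply₂ nthC fstC (compose π₁C (compose π₂C sndC))) (constant 0))))

  Valid : ℕ → Set
  Valid c = validity c ≡ 0

  Step : (D M : ℕ → Set) → ℕ → Set
  Step D M v = ⟦ rule ⟧ D M (v ∷ [])

  Mem-before : ∀ {i c u} → Mem (before i c) u → ∃ λ j → j < i × fact j c ≡ u
  Mem-before {i} {c} (j , p , q) rewrite len-before i c | rest-before i c = j , p , q

  before-Mem : ∀ {i c j} → j < i → Mem (before i c) (fact j c)
  before-Mem {i} {c} {j} p =
    j , subst (j <_) (sym (len-before i c)) p , cong (nth j ∘ π₁) (rest-before i c)

  Dom-before : ∀ {i c w} → Dom (before i c) w → Dom c w
  Dom-before {i} {c} rewrite rest-before i c = id

  before-Dom : ∀ {i c w} → Dom c w → Dom (before i c) w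
  before-Dom {i} {c} rewrite rest-before i c = id

  valid-step : ∀ c → Valid c → ∀ i → i < len c → Step (Dom (before i c)) (Mem (before i c)) (fact i c)
  valid-step c v i p = value-to rule (to (sumTo≡0 (len c)) v i p)

  step-valid : ∀ c → (∀ i → i < len c → Step (Dom (before i c)) (Mem (before i c)) (fact i c)) → Valid c
  step-valid c h = from (sumTo≡0 (len c)) λ i p → value-from rule (h i p)

  record Derivable (u : ℕ) : Set where
    constructor derivation
    field
      certificate : ℕ
      valid       : Valid certificate
      member      : Mem certificate u

  -- Course-of-values induction on the position in the certificate: every entry is justified by
  -- entries at smaller positions.
  derivable-ind : (P : ℕ → Set) → (∀ v → Step (λ _ → ⊤) P v → P v) → ∀ {u} → Derivable u → P u
  derivable-ind P closed (derivation c valid (j , j<len , refl)) = go (suc j) j ≤-refl j<len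
    where
    go : ∀ n j → j < n → j < len c → P (fact j c)
    go (suc n) j j<n j<len = closed _ (mono rule _ members (valid-step c valid j j<len))
      where
      members : ∀ {u} → Mem (before j c) u → P u
      members m with Mem-before {j} {c} m
      ... | i , i<j , refl = go n i (<-≤-trans i<j (s≤s⁻¹ j<n)) (<-trans i<j j<len)

  -- Extending and joining certificates

  infix 4 _⊑_
  -- Facts are compared as sets, not by position, so that the second certificate in a concatenation
  -- also lies below the result.
  record _⊑_ (c d : ℕ) : Set where
    field
      members : ∀ {u} → Mem c u → Mem d u
      bounds  : bound c ≤ bound d

    doms : ∀ {w} → Dom c w → Dom d w
    doms p = <-≤-trans p bounds

  open _⊑_

  module _ (c m : ℕ) (g : ℕ → ℕ) (b : ℕ) where

    private
      appended : ℕ → ℕ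
      appended j with j <? len c
      ... | yes _ = fact j c
      ... | no  _ = g (j ∸ len c)

      appended-old : ∀ {j} → j < len c → appended j ≡ fact j c
      appended-old {j} p with j <? len c
      ... | yes _ = refl
      ... | no ¬p = contradiction p ¬p

      appended-new : ∀ k → appended (len c + k) ≡ g k
      appended-new k with len c + k <? len c
      ... | yes p = contradiction p (m+n≮m (len c) k)
      ... | no  _ = cong g (m+n∸m≡n (len c) k)

    append : ℕ
    append = ⟪ len c + m , ⟪ tuple (len c + m) (appended ∘ toℕ) , b ⟫ ⟫

    len-append : len append ≡ len c + m
    len-append = π₁-⟪⟫ _ _

    bound-append : bound append ≡ b
    bound-append = trans (cong π₂ (π₂-⟪⟫ _ _)) (π₂-⟪⟫ _ _)

    private
      fact-append : ∀ {j} → j < len c + m → fact j append ≡ appended j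
      fact-append {j} p =
        trans (cong (nth j) (trans (cong π₁ (π₂-⟪⟫ _ _)) (π₁-⟪⟫ _ _)))
          (trans (nth-tuple-< (appended ∘ toℕ) p) (cong appended (toℕ-fromℕ< p)))

    fact-old : ∀ {j} → j < len c → fact j append ≡ fact j c
    fact-old p = trans (fact-append (m≤n⇒m≤n+o m p)) (appended-old p)

    fact-new : ∀ {k} → k < m → fact (len c + k) append ≡ g k
    fact-new {k} p = trans (fact-append (+-monoʳ-< (len c) p)) (appended-new k)

    append-new : ∀ {k} → k < m → Mem append (g k)
    append-new {k} p = len c + k , subst (_ <_) (sym len-append) (+-monoʳ-< (len c) p) , fact-new p

    append-⊑ : bound c ≤ b → c ⊑ append
    append-⊑ c≤b .members (j , p , q) =
      j , subst (j <_) (sym len-append) (m≤n⇒m≤n+o m p) , trans (fact-old p) q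
    append-⊑ c≤b .bounds = subst (bound c ≤_) (sym bound-append) c≤b

    -- Old steps remain correct because their facts keep their positions, the bound only grows and
    -- the rule is positive. A new fact may use all old facts and the new facts preceding it.
    append-valid : Valid c → bound c ≤ b →
      (∀ k → k < m → Step (_< b) (λ u → Mem c u ⊎ ∃ λ j → j < k × g j ≡ u) (g k)) → Valid append
    append-valid valid c≤b new = step-valid append step
      where
      step : ∀ i → i < len append → Step (Dom (before i append)) (Mem (before i append)) (fact i append)
      step i i<len with i <? len c
      ... | yes p = subst (Step (Dom (before i append)) (Mem (before i append))) (sym (fact-old p))
        (mono rule dom old (valid-step c valid i p))
        where
        dom : ∀ {w} → Dom (before i c) w → Dom (before i append) w
        dom d = before-Dom {i} {append} (doms (append-⊑ c≤b) (Dom-before {i} {c} d))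
        old : ∀ {u} → Mem (before i c) u → Mem (before i append) u
        old h with Mem-before {i} {c} h
        ... | j , j<i , refl =
          subst (Mem (before i append)) (fact-old (<-trans j<i p)) (before-Mem {i} {append} j<i)
      ... | no ¬p with m≤n⇒∃[o]m+o≡n (≮⇒≥ ¬p)
      ... | k , refl =
        subst (Step (Dom (before (len c + k) append)) (Mem (before (len c + k) append))) (sym (fact-new k<m))
          (mono rule dom both (new k k<m))
        where
        k<m : k < m
        k<m = +-cancelˡ-< (len c) k m (subst (_ <_) len-append i<len)
        dom : ∀ {w} → w < b → Dom (before (len c + k) append) w
        dom d = before-Dom {len c + k} {append} (subst (_ <_) (sym bound-append) d)
        both : ∀ {u} → Mem c u ⊎ (∃ λ j → j < k × g j ≡ u) → Mem (before (len c + k) append) u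
        both (inj₁ (j , q , refl)) =
          subst (Mem (before (len c + k) append)) (fact-old q)
            (before-Mem {len c + k} {append} (m≤n⇒m≤n+o k q))
        both (inj₂ (j , q , refl)) =
          subst (Mem (before (len c + k) append)) (fact-new (<-trans q k<m))
            (before-Mem {len c + k} {append} (+-monoʳ-< (len c) q))

  Below : (ℕ → Set) → Set
  Below P = ∃ λ c → Valid c × P c

  join : ∀ c d → Valid c → Valid d → ∃ λ e → Valid e × c ⊑ e × d ⊑ e
  join c d vc vd =
    append c m g b ,
    -- The facts of d keep their order, so what step k of d refers to is found among the new facts
    -- before k.
    append-valid c m g b vc (m≤m⊔n _ _) (λ k k<m →
      mono rule (λ p → <-≤-trans (Dom-before {k} {d} p) (m≤n⊔m _ _)) (λ h → inj₂ (Mem-before {k} {d} h))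
        (valid-step d vd k k<m)) ,
    append-⊑ c m g b (m≤m⊔n _ _) ,
    record { members = λ { (j , p , refl) → append-new c m g b p }
           ; bounds  = subst (bound d ≤_) (sym (bound-append c m g b)) (m≤n⊔m _ _) }
    where
    m = len d
    g = λ j → fact j d
    b = bound c ⊔ bound d

  empty : ℕ
  empty = ⟪ 0 , 0 ⟫

  empty-valid : Valid empty
  empty-valid = step-valid empty λ i p → contradiction (subst (i <_) (π₁-⟪⟫ 0 0) p) λ ()

  widen : ∀ c b → Valid c → ∃ λ d → Valid d × c ⊑ d × b ≤ bound d
  widen c b v = append c 0 id b′ , append-valid c 0 id b′ v (m≤m⊔n _ _) (λ _ ()) ,
    append-⊑ c 0 id b′ (m≤m⊔n _ _) ,
    subst (b ≤_) (sym (bound-append c 0 id b′)) (m≤n⊔m _ _)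
    where b′ = bound c ⊔ b

  Holds : ∀ {n} → Fm n → Vec ℕ n → Set
  Holds φ = ⟦ φ ⟧ (λ _ → ⊤) Derivable

  ⊑-mono : ∀ {n} (φ : Fm n) {ρ c d} → c ⊑ d → ⟦ φ ⟧ (Dom c) (Mem c) ρ → ⟦ φ ⟧ (Dom d) (Mem d) ρ
  ⊑-mono φ le = mono φ (doms le) (members le)

  -- Universal quantifiers are bounded, so the truth of a formula involves finitely many facts and
  -- witnesses; their certificates can be joined into one.
  compactness : ∀ {n} (φ : Fm n) {ρ} → Holds φ ρ → Below (λ c → ⟦ φ ⟧ (Dom c) (Mem c) ρ)
  compactness (a == b)  h = empty , empty-valid , h
  compactness (a =/= b) h = empty , empty-valid , h
  compactness (a << b)  h = empty , empty-valid , h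
  compactness (φ ∧ ψ) (g , h) with compactness φ g | compactness ψ h
  ... | c , vc , p | d , vd , q with join c d vc vd
  ... | e , ve , l₁ , l₂ = e , ve , ⊑-mono φ l₁ p , ⊑-mono ψ l₂ q
  compactness (φ ∨ ψ) (inj₁ h) = map₂ (map₂ inj₁) (compactness φ h)
  compactness (φ ∨ ψ) (inj₂ h) = map₂ (map₂ inj₂) (compactness ψ h)
  compactness (all< b φ) {ρ} h = go (⟦ b ⟧ₑ ρ) h
    where
    go : ∀ m → (∀ i → i < m → Holds φ (i ∷ ρ)) →
         Below (λ c → ∀ i → i < m → ⟦ φ ⟧ (Dom c) (Mem c) (i ∷ ρ))
    go zero    h = empty , empty-valid , λ _ ()
    go (suc m) h with go m (λ i p → h i (m≤n⇒m≤1+n p)) | compactness φ (h m ≤-refl)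
    ... | c , vc , p | d , vd , q with join c d vc vd
    ... | e , ve , l₁ , l₂ = e , ve , both
      where
      both : ∀ i → i < suc m → ⟦ φ ⟧ (Dom e) (Mem e) (i ∷ ρ)
      both i i<1+m with m≤n⇒m<n∨m≡n (s≤s⁻¹ i<1+m)
      ... | inj₁ i<m  = ⊑-mono φ l₁ (p i i<m)
      ... | inj₂ refl = ⊑-mono φ l₂ q
  compactness (ex φ) (w , _ , h) with compactness φ h
  -- The bound on witnesses is strict, hence `suc w`.
  ... | c , vc , p with widen c (suc w) vc
  ... | d , vd , l , b = d , vd , w , b , ⊑-mono φ l p
  compactness (mem a) (derivation c v m) = c , v , m

  derive : ∀ {v} → Holds rule (v ∷ []) → Derivable v
  derive {v} h with compactness rule h
  ... | c , vc , p =
    derivation (append c 1 (const v) (bound c))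
      (append-valid c 1 (const v) (bound c) vc ≤-refl (λ _ _ → mono rule id inj₁ p))
      (append-new c 1 (const v) (bound c) (s≤s z≤n))

  holds-valid : ∀ {n} (φ : Fm n) c {ρ} → Valid c → ⟦ φ ⟧ (Dom c) (Mem c) ρ → Holds φ ρ
  holds-valid φ c v = mono φ _ (λ m → derivation c v m)

  semidecide : (φ : Fm 2) →
    Σ Code λ U → ∀ x z → (∃ λ y → U ⟨ ⟪ x , z ⟫ ⟩⇓ y) ⇔ Holds φ (x ∷ z ∷ [])
  semidecide φ = cMin (proj₁ checkC) , λ x z → mk⇔ (λ (y , h) → sound x z y (proj₁ (inv h))) (complete x z)
    where
    check : ℕ → ℕ → ℕ → ℕ
    check c x z = validity c + value φ c (x ∷ z ∷ [])
    checkC : Computes {ℕ × ℕ × ℕ} (λ (x , z , c) → ⟪ ⟪ x , z ⟫ , c ⟫) (λ (x , z , c) → check c x z)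
    checkC = apply₂ plusC (compose validityC sndC)
      (compose {g = λ (x , z , c) → c , x ∷ z ∷ []} (valueC φ)
        (pairing sndC (pairing (compose {g = λ (x , z , c) → x , z} fstC fstC)
          (pairing (compose {g = λ (x , z , c) → x , z} sndC fstC) (constant 0)))))
    sound : ∀ x z c → proj₁ checkC ⟨ ⟪ ⟪ x , z ⟫ , c ⟫ ⟩⇓ 0 → Holds φ (x ∷ z ∷ [])
    sound x z c h with ⇓-det (proj₂ checkC (x , z , c)) h
    ... | eq = holds-valid φ c (m+n≡0⇒m≡0 (validity c) eq) (value-to φ {c} (m+n≡0⇒n≡0 (validity c) eq))
    complete : ∀ x z → Holds φ (x ∷ z ∷ []) → ∃ λ y → cMin (proj₁ checkC) ⟨ ⟪ x , z ⟫ ⟩⇓ y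
    complete x z h with compactness φ h
    ... | c , vc , p = least c (cong₂ _+_ vc (value-from φ {c} p))
      where
      total : ∀ m → proj₁ checkC ⟨ ⟪ ⟪ x , z ⟫ , m ⟫ ⟩⇓ check m x z
      total m = proj₂ checkC (x , z , m)
      Nonzero : ℕ → Set
      Nonzero m = Σ ℕ λ k → proj₁ checkC ⟨ ⟪ ⟪ x , z ⟫ , m ⟫ ⟩⇓ suc k
      search : ∀ n → (∃ λ m → check m x z ≡ 0 × (∀ i → i < m → Nonzero i)) ⊎ (∀ i → i < n → Nonzero i)
      search zero = inj₂ λ _ ()
      search (suc n) with search n
      ... | inj₁ r = inj₁ r
      ... | inj₂ r with check n x z in eq
      ... | zero  = inj₁ (n , eq , r)
      ... | suc k = inj₂ λ i i<1+n →
        [ r i , (λ { refl → k , subst (proj₁ checkC ⟨ ⟪ ⟪ x , z ⟫ , n ⟫ ⟩⇓_) eq (total n) }) ]′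
          (m≤n⇒m<n∨m≡n (s≤s⁻¹ i<1+n))
      least : ∀ c → check c x z ≡ 0 → ∃ λ y → cMin (proj₁ checkC) ⟨ ⟪ x , z ⟫ ⟩⇓ y
      -- `cMin` demands the least zero, while compactness yields just some zero c; the search
      -- therefore runs up to c inclusive.
      least c eq with search (suc c)
      ... | inj₁ (m , eq′ , r) =
        m , unInv (cMin _) (subst (proj₁ checkC ⟨ ⟪ ⟪ x , z ⟫ , m ⟫ ⟩⇓_) eq′ (total m) , r)
      ... | inj₂ r = contradiction (trans (sym eq) (⇓-det (total c) (proj₂ (r c ≤-refl)))) λ ()

  uniformly-ce : (φ : Fm 2) →
    Σ (ℕ → ℕ) λ h → Computable h × (∀ x z → z ∈W h x ⇔ Holds φ (x ∷ z ∷ []))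
  uniformly-ce φ =
    let (U , U-spec) = semidecide φ
        (h , comp , h-spec) = s-m-n U
    in h , comp , λ x z → mk⇔ (to (U-spec x z) ∘ to (h-spec x z)) (from (h-spec x z) ∘ from (U-spec x z))

  -- A number d is read as a candidate element `π₁ d` together with a certificate `π₂ d`. Zeros of
  -- this function thus enumerate the set defined by φ at x in a decidable way.
  stage : (φ : Fm 2) → ℕ → ℕ → ℕ
  stage φ x d = validity (π₂ d) + value φ (π₂ d) (x ∷ π₁ d ∷ [])

  stageC : (φ : Fm 2) → Computes₂ (stage φ)
  stageC φ = apply₂ plusC (compose validityC (compose π₂C sndC))
    (compose {g = λ (x , d) → π₂ d , x ∷ π₁ d ∷ []} (valueC φ)
      (pairing (compose π₂C sndC) (pairing fstC (pairing (compose π₁C sndC) (constant 0)))))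

  stage-sound : (φ : Fm 2) → ∀ {x d} → stage φ x d ≡ 0 → Holds φ (x ∷ π₁ d ∷ [])
  stage-sound φ {x} {d} eq =
    holds-valid φ (π₂ d) (m+n≡0⇒m≡0 (validity (π₂ d)) eq)
    (value-to φ {π₂ d} (m+n≡0⇒n≡0 (validity (π₂ d)) eq))

  stage-complete : (φ : Fm 2) → ∀ {x n} → Holds φ (x ∷ n ∷ []) → ∃ λ d → stage φ x d ≡ 0 × π₁ d ≡ n
  stage-complete φ {x} {n} h with compactness φ h
  ... | c , vc , p = ⟪ n , c ⟫ , eq , π₁-⟪⟫ n c
    where
    eq : stage φ x ⟪ n , c ⟫ ≡ 0
    eq rewrite π₁-⟪⟫ n c | π₂-⟪⟫ n c = cong₂ _+_ vc (value-from φ {c} p)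

-- Evaluation as a Σ₁ rule

-- De Bruijn indices: `v 0` is the variable bound innermost.
v : ∀ i {n} → Exp (suc i + n)
v i = var (fromℕ i ↑ˡ _)

wk : ∀ {n} → Exp n → Exp (suc n)
wk (var i)       = var (suc i)
wk (lit m)       = lit m
wk (op₁ f F a)   = op₁ f F (wk a)
wk (op₂ f F a b) = op₂ f F (wk a) (wk b)

infixl 7 _⊕_
infixl 8 _⊗_

su fs sn : ∀ {n} → Exp n → Exp n
su = op₁ suc (successor identity)
fs = op₁ π₁ π₁C
sn = op₁ π₂ π₂C

pr nt _⊕_ _⊗_ : ∀ {n} → Exp n → Exp n → Exp n
pr  = op₂ ⟪_,_⟫ pairC
nt  = op₂ nth nthC
_⊕_ = op₂ _+_ plusC
_⊗_ = op₂ _*_ timesC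

pattern case₀ p = inj₁ p
pattern case₁ p = inj₂ (inj₁ p)
pattern case₂ p = inj₂ (inj₂ (inj₁ p))
pattern case₃ p = inj₂ (inj₂ (inj₂ (inj₁ p)))
pattern case₄ p = inj₂ (inj₂ (inj₂ (inj₂ (inj₁ p))))
pattern case₅ p = inj₂ (inj₂ (inj₂ (inj₂ (inj₂ (inj₁ p)))))
pattern case₆ p = inj₂ (inj₂ (inj₂ (inj₂ (inj₂ (inj₂ (inj₁ p))))))
pattern case₇ p = inj₂ (inj₂ (inj₂ (inj₂ (inj₂ (inj₂ (inj₂ (inj₁ p)))))))
pattern case₈ p = inj₂ (inj₂ (inj₂ (inj₂ (inj₂ (inj₂ (inj₂ (inj₂ p)))))))

-- Sub m σ t t′ says that t′ codes the result of substituting the tuple of codes σ into the term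
-- over X_{m+1} coded by t; Eqn x a b says that the terms coded by a and b are equal in the algebra x.
Ev : ℕ → ℕ → ℕ → ℕ
Ev e x y = ⟪ 0 , ⟪ e , ⟪ x , y ⟫ ⟫ ⟫

Sub : ℕ → ℕ → ℕ → ℕ → ℕ
Sub m σ t t′ = ⟪ 1 , ⟪ m , ⟪ σ , ⟪ t , t′ ⟫ ⟫ ⟫ ⟫

Eqn : ℕ → ℕ → ℕ → ℕ
Eqn x a b = ⟪ 2 , ⟪ x , ⟪ a , b ⟫ ⟫ ⟫

evᵉ eqnᵉ : ∀ {n} → Exp n → Exp n → Exp n → Exp n
evᵉ e x y  = pr (lit 0) (pr e (pr x y))
eqnᵉ x a b = pr (lit 2) (pr x (pr a b))

subᵉ : ∀ {n} → Exp n → Exp n → Exp n → Exp n → Exp n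
subᵉ m σ t t′ = pr (lit 1) (pr m (pr σ (pr t t′)))

-- The universal machine in relational form, with a clause for each constructor of `Code`. The
-- environment holds y, x, e and, from the enclosing `rule`, the fact being derived.
evRule : Fm 4
-- Tags above 8 also decode to `cZero`.
evRule = (tag 0 ∨ lit 8 << fs e) ∧ y == lit 0
       ∨ tag 1 ∧ y == su x
       ∨ tag 2 ∧ y == x
       ∨ tag 3 ∧ y == fs x
       ∨ tag 4 ∧ y == sn x
       ∨ tag 5 ∧ ex (mem (evᵉ (wk e₁) (wk x) (v 0)) ∧ mem (evᵉ (wk e₀) (v 0) (wk y)))
       ∨ tag 6 ∧ mem (evᵉ e₀ x (fs y)) ∧ mem (evᵉ e₁ x (sn y))
       ∨ tag 7 ∧ (sn x == lit 0 ∧ mem (evᵉ e₀ (fs x) y)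
                 ∨ ex (ex (sn (wk (wk x)) == su (v 1)
                          -- The preceding stage of the recursion is an evaluation of the whole
                          -- index e again, at a smaller argument.
                          ∧ mem (evᵉ (wk (wk e)) (pr (fs (wk (wk x))) (v 1)) (v 0))
                          ∧ mem (evᵉ (wk (wk e₁)) (pr (fs (wk (wk x))) (pr (v 1) (v 0))) (wk (wk y))))))
       ∨ tag 8 ∧ mem (evᵉ (sn e) (pr x y) (lit 0))
               ∧ all< y (ex (mem (evᵉ (wk (wk (sn e))) (pr (wk (wk x)) (v 1)) (su (v 0)))))
  where
  y x e e₀ e₁ : Exp 4
  y = v 0
  x = v 1
  e = v 2
  e₀ = nt (lit 0) (sn e)
  e₁ = nt (lit 1) (sn e)
  tag : ℕ → Fm 4
  tag t = fs e == lit t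

φ-at : ∀ e {t} → π₁ e ≡ t → φ e ≡ shape φ t (π₂ e)
φ-at e refl = φ-shape e

shape-large : ∀ F {t r} → 8 < t → shape F t r ≡ cZero
shape-large F {suc (suc (suc (suc (suc (suc (suc (suc (suc t))))))))} _ = refl
shape-large F {0} ()
shape-large F {1} (s≤s ())
shape-large F {2} (s≤s (s≤s ()))
shape-large F {3} (s≤s (s≤s (s≤s ())))
shape-large F {4} (s≤s (s≤s (s≤s (s≤s ()))))
shape-large F {5} (s≤s (s≤s (s≤s (s≤s (s≤s ())))))
shape-large F {6} (s≤s (s≤s (s≤s (s≤s (s≤s (s≤s ()))))))
shape-large F {7} (s≤s (s≤s (s≤s (s≤s (s≤s (s≤s (s≤s ())))))))
shape-large F {8} (s≤s (s≤s (s≤s (s≤s (s≤s (s≤s (s≤s (s≤s ()))))))))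

evRule-sound : ∀ (M : ℕ → Set) → (∀ {e x y} → M (Ev e x y) → φ e ⟨ x ⟩⇓ y) →
               ∀ {y x e u} → ⟦ evRule ⟧ (λ _ → ⊤) M (y ∷ x ∷ e ∷ u ∷ []) → φ e ⟨ x ⟩⇓ y
evRule-sound M out {y} {x} {e} {u} = go
  where
  with-tag : ∀ {t} → π₁ e ≡ t → shape φ t (π₂ e) ⟨ x ⟩⇓ y → φ e ⟨ x ⟩⇓ y
  with-tag t = subst (_⟨ x ⟩⇓ y) (sym (φ-at e t))
  go : ⟦ evRule ⟧ (λ _ → ⊤) M (y ∷ x ∷ e ∷ u ∷ []) → φ e ⟨ x ⟩⇓ y
  go (case₀ (inj₁ t , refl)) = with-tag t ev-zero
  go (case₀ (inj₂ t , refl)) = with-tag refl (subst (_⟨ x ⟩⇓ 0) (sym (shape-large φ t)) ev-zero)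
  go (case₁ (t , refl))      = with-tag t ev-succ
  go (case₂ (t , refl))      = with-tag t ev-id
  go (case₃ (t , refl))      = with-tag t (unInv cFst refl)
  go (case₄ (t , refl))      = with-tag t (unInv cSnd refl)
  go (case₅ (t , w , _ , p , q)) = with-tag t (ev-comp (out p) (out q))
  go (case₆ (t , p , q))     = with-tag t (unInv (cPair _ _) (out p , out q))
  go (case₇ (t , inj₁ (z , p))) = with-tag t (unInv (cRec _ _) (inj₁ (z , out p)))
  go (case₇ (t , inj₂ (n , _ , z , _ , s , p , q))) =
    with-tag t (unInv (cRec _ _) (inj₂ (n , z , s , subst (_⟨ ⟪ π₁ x , n ⟫ ⟩⇓ z) (φ-at e t) (out p) , out q)))
  go (case₈ (t , p , q)) =
    with-tag t (unInv (cMin _) (out p , λ m m<y → let (k , _ , r) = q m m<y in k , out r))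

-- Generalises `φ e` to an index while remembering the tag of e, so that an evaluation of `φ e` can
-- be analysed by its constructors.
data Tagged (e : ℕ) : Code → Set where
  tag-zero : π₁ e ≡ 0 ⊎ 8 < π₁ e → Tagged e cZero
  tag-succ : π₁ e ≡ 1 → Tagged e cSucc
  tag-id   : π₁ e ≡ 2 → Tagged e cId
  tag-fst  : π₁ e ≡ 3 → Tagged e cFst
  tag-snd  : π₁ e ≡ 4 → Tagged e cSnd
  tag-comp : π₁ e ≡ 5 → Tagged e (cComp (φ (nth 0 (π₂ e))) (φ (nth 1 (π₂ e))))
  tag-pair : π₁ e ≡ 6 → Tagged e (cPair (φ (nth 0 (π₂ e))) (φ (nth 1 (π₂ e))))
  tag-rec  : π₁ e ≡ 7 → Tagged e (cRec (φ (nth 0 (π₂ e))) (φ (nth 1 (π₂ e))))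
  tag-min  : π₁ e ≡ 8 → Tagged e (cMin (φ (π₂ e)))

tagged : ∀ e → Tagged e (φ e)
tagged e = subst (Tagged e) (sym (φ-shape e)) (go (π₁ e) refl)
  where
  go : ∀ t → π₁ e ≡ t → Tagged e (shape φ t (π₂ e))
  go 0 eq = tag-zero (inj₁ eq)
  go 1 eq = tag-succ eq
  go 2 eq = tag-id eq
  go 3 eq = tag-fst eq
  go 4 eq = tag-snd eq
  go 5 eq = tag-comp eq
  go 6 eq = tag-pair eq
  go 7 eq = tag-rec eq
  go 8 eq = tag-min eq
  go (suc (suc (suc (suc (suc (suc (suc (suc (suc t))))))))) eq =
    tag-zero (inj₂ (subst (8 <_) (sym eq) (m≤m+n 9 t)))

module _ (M : ℕ → Set)
         (intro : ∀ {y x e} → (∀ u → ⟦ evRule ⟧ (λ _ → ⊤) M (y ∷ x ∷ e ∷ u ∷ [])) → M (Ev e x y)) where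

  evRule-complete : ∀ {e x y} → φ e ⟨ x ⟩⇓ y → M (Ev e x y)
  evRule-complete d = go d (tagged _)
    where
    go  : ∀ {c e x y} → c ⟨ x ⟩⇓ y → Tagged e c → M (Ev e x y)
    -- Receiving the whole pair as an argument keeps the evaluation inside it structurally smaller
    -- than the `ev-min` it comes from.
    go∃ : ∀ {c e x} → Σ ℕ (λ k → c ⟨ x ⟩⇓ suc k) → Tagged e c → ∃ λ k → ⊤ × M (Ev e x (suc k))
    go ev-zero (tag-zero t) = intro λ _ → case₀ (t , refl)
    go ev-succ (tag-succ t) = intro λ _ → case₁ (t , refl)
    go ev-id (tag-id t) = intro λ _ → case₂ (t , refl)
    go (ev-fst {a} {b}) (tag-fst t) = intro λ _ → case₃ (t , cong proj₁ (sym (unpair-pair a b)))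
    go (ev-snd {a} {b}) (tag-snd t) = intro λ _ → case₄ (t , cong proj₂ (sym (unpair-pair a b)))
    go (ev-comp p q) (tag-comp t) =
      intro λ _ → case₅ (t , _ , tt , go p (tagged _) , go q (tagged _))
    go {x = x} (ev-pair {y = y} {z = z} p q) (tag-pair t) = intro λ _ → case₆
      ( t
      , subst (M ∘ Ev _ x) (cong proj₁ (sym (unpair-pair y z))) (go p (tagged _))
      , subst (M ∘ Ev _ x) (cong proj₂ (sym (unpair-pair y z))) (go q (tagged _)))
    go {y = y} (ev-rec0 {a = a} p) (tag-rec t) = intro λ _ → case₇
      (t , inj₁
        ( cong proj₂ (unpair-pair a 0)
        , subst (λ b → M (Ev _ b y)) (cong proj₁ (sym (unpair-pair a 0))) (go p (tagged _))))
    go {y = y} (ev-recS {a = a} {n = n} {z = z} p q) (tag-rec t) = intro λ _ → case₇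
      (t , inj₂ (n , tt , z , tt
        , cong proj₂ (unpair-pair a (suc n))
        , subst (λ b → M (Ev _ b z)) (trans (pair≡⟪⟫ a n) (cong ⟪_, n ⟫ a≡)) (go p (tag-rec t))
        , subst (λ b → M (Ev _ b y))
            (trans (cong (pair a) (pair≡⟪⟫ n z)) (trans (pair≡⟪⟫ a _) (cong ⟪_, _ ⟫ a≡)))
            (go q (tagged _))))
      where
      a≡ : a ≡ π₁ (pair a (suc n))
      a≡ = cong proj₁ (sym (unpair-pair a (suc n)))
    go {x = a} (ev-min {n = n} p q) (tag-min t) = intro λ _ → case₈
      ( t
      , subst (λ b → M (Ev _ b 0)) (pair≡⟪⟫ a n) (go p (tagged _))
      , λ m m<n → subst (λ b → ∃ λ k → ⊤ × M (Ev _ b (suc k))) (pair≡⟪⟫ a m)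
                    (go∃ (q m m<n) (tagged _)))
    go∃ (k , d) t = k , tt , go d t

module _ (V : Variety) where

  open Variety V

  -- Terms and congruences

  D : ∀ k → ℕ → Term V (suc k)
  D k n = decodeT V k (suc n) n

  -- Without function extensionality, terms with pointwise equal arguments need not be ≡.
  infix 4 _≈_
  data _≈_ {k} : Term V k → Term V k → Set where
    ≈-var : ∀ {i} → var i ≈ var i
    ≈-app : ∀ {s ts us} → (∀ i → ts i ≈ us i) → app s ts ≈ app s us

  ≈-refl : ∀ {k} {t : Term V k} → t ≈ t
  ≈-refl {t = var i}    = ≈-var
  ≈-refl {t = app s ts} = ≈-app λ i → ≈-refl

  ≡⇒≈ : ∀ {k} {t u : Term V k} → t ≡ u → t ≈ u
  ≡⇒≈ refl = ≈-refl

  ≈-trans : ∀ {k} {t u v : Term V k} → t ≈ u → u ≈ v → t ≈ v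
  ≈-trans ≈-var q = q
  ≈-trans (≈-app p) (≈-app q) = ≈-app λ i → ≈-trans (p i) (q i)

  ≈-substT : ∀ {m k} (σ : Fin m → Term V k) {t u} → t ≈ u → substT V σ t ≈ substT V σ u
  ≈-substT σ ≈-var     = ≈-refl
  ≈-substT σ (≈-app p) = ≈-app λ i → ≈-substT σ (p i)

  substT-∘ : ∀ {l m k} (τ : Fin m → Term V k) (σ : Fin l → Term V m) t →
             substT V τ (substT V σ t) ≈ substT V (substT V τ ∘ σ) t
  substT-∘ τ σ (var i)    = ≈-refl
  substT-∘ τ σ (app s ts) = ≈-app λ i → substT-∘ τ σ (ts i)

  substT-var : ∀ {k} (t : Term V k) → substT V var t ≈ t
  substT-var (var i)    = ≈-var
  substT-var (app s ts) = ≈-app λ i → substT-var (ts i)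

  -- Cg with an arbitrary set R of relations, not given by an index, in place of W_e.
  data Gen (k : ℕ) (R : ℕ → Set) : Term V (suc k) → Term V (suc k) → Set where
    gen-rel : ∀ n → R n → Gen k R (D k (π₁ n)) (D k (π₂ n))
    gen-law : ∀ n → n ∈W lawIdx → (σ : Fin (suc (lawVars V n)) → Term V (suc k)) →
              Gen k R (substT V σ (proj₁ (lawEq V n))) (substT V σ (proj₂ (lawEq V n)))
    gen-refl : ∀ {t} → Gen k R t t
    gen-sym  : ∀ {t u} → Gen k R t u → Gen k R u t
    gen-trans : ∀ {t u v} → Gen k R t u → Gen k R u v → Gen k R t v
    gen-cong : ∀ s {ts us} → (∀ i → Gen k R (ts i) (us i)) → Gen k R (app s ts) (app s us)

  Gen-mono : ∀ {k R S} → (∀ {n} → R n → S n) → ∀ {t u} → Gen k R t u → Gen k S t u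
  Gen-mono f (gen-rel n r)    = gen-rel n (f r)
  Gen-mono f (gen-law n w σ)  = gen-law n w σ
  Gen-mono f gen-refl        = gen-refl
  Gen-mono f (gen-sym p)     = gen-sym (Gen-mono f p)
  Gen-mono f (gen-trans p q) = gen-trans (Gen-mono f p) (Gen-mono f q)
  Gen-mono f (gen-cong s p)  = gen-cong s λ i → Gen-mono f (p i)

  Cg⇒Gen : ∀ {k e R} → (∀ {n} → n ∈W e → Gen k R (D k (π₁ n)) (D k (π₂ n))) →
           ∀ {t u} → Cg V k e t u → Gen k R t u
  Cg⇒Gen f (cg-rel n w)   = f w
  Cg⇒Gen f (cg-law n w σ) = gen-law n w σ
  Cg⇒Gen f cg-refl        = gen-refl
  Cg⇒Gen f (cg-sym p)     = gen-sym (Cg⇒Gen f p)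
  Cg⇒Gen f (cg-trans p q) = gen-trans (Cg⇒Gen f p) (Cg⇒Gen f q)
  Cg⇒Gen f (cg-cong s p)  = gen-cong s λ i → Cg⇒Gen f (p i)

  module _ {k e : ℕ} where

    ≈⇒Cg : ∀ {t u} → t ≈ u → Cg V k e t u
    ≈⇒Cg ≈-var     = cg-refl
    ≈⇒Cg (≈-app p) = cg-cong _ λ i → ≈⇒Cg (p i)

    ≡⇒Cg : ∀ {t u} → t ≡ u → Cg V k e t u
    ≡⇒Cg refl = cg-refl

    Cg-substT : ∀ {m} {σ τ : Fin m → Term V (suc k)} → (∀ i → Cg V k e (σ i) (τ i)) →
                ∀ t → Cg V k e (substT V σ t) (substT V τ t)
    Cg-substT h (var i)    = h i
    Cg-substT h (app s ts) = cg-cong s λ i → Cg-substT h (ts i)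

    -- Von Dyck's principle: substitution maps instances of laws to instances of laws, so only the
    -- relations in `R` have to be checked for a homomorphism.
    Gen-lift : ∀ {j R} (σ : Fin (suc j) → Term V (suc k)) →
               (∀ {n} → R n → Cg V k e (substT V σ (D j (π₁ n))) (substT V σ (D j (π₂ n)))) →
               ∀ {t u} → Gen j R t u → Cg V k e (substT V σ t) (substT V σ u)
    Gen-lift σ f (gen-rel n r)    = f r
    Gen-lift σ f (gen-law n w τ)  = cg-trans (≈⇒Cg (substT-∘ σ τ (proj₁ (lawEq V n))))
      (cg-trans (cg-law n w (substT V σ ∘ τ)) (cg-sym (≈⇒Cg (substT-∘ σ τ (proj₂ (lawEq V n))))))
    Gen-lift σ f gen-refl        = cg-refl
    Gen-lift σ f (gen-sym p)     = cg-sym (Gen-lift σ f p)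
    Gen-lift σ f (gen-trans p q) = cg-trans (Gen-lift σ f p) (Gen-lift σ f q)
    Gen-lift σ f (gen-cong s p)  = cg-cong s λ i → Gen-lift σ f (p i)

  -- Surjective homomorphisms and the ascending chain condition

  -- A homomorphism is given by the images of the generators, and surjectivity by preimages of the
  -- generators. Substituting the latter gives `choose`, a section that is not assumed to respect
  -- equality.
  record Onto (x y : ℕ) : Set where
    field
      img  : Fin (suc (gens V x)) → Carrier V y
      pre  : Fin (suc (gens V y)) → Carrier V x
      map-resp : ∀ {t u} → Eq V x t u → Eq V y (substT V img t) (substT V img u)
      surj : ∀ i → Eq V y (substT V img (pre i)) (var i)

    map    = substT V img
    choose = substT V pre

    map-choose : ∀ t → Eq V y (map (choose t)) t
    map-choose t = cg-trans (≈⇒Cg (substT-∘ img pre t))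
      (cg-trans (Cg-substT surj t) (≈⇒Cg (substT-var t)))

  open Onto

  iterate : ∀ {A : Set} → (A → A) → ℕ → A → A
  iterate f zero    a = a
  iterate f (suc n) a = iterate f n (f a)

  iterate-shift : ∀ {A : Set} (f : A → A) n a → iterate f n (f a) ≡ f (iterate f n a)
  iterate-shift f zero    a = refl
  iterate-shift f (suc n) a = iterate-shift f n (f a)

  module _ (acc : ACC V) where

    module _ (x : ℕ) (f g : Carrier V x → Carrier V x)
             (resp-f : ∀ {t u} → Eq V x t u → Eq V x (f t) (f u))
             (hom : ∀ s ts → Eq V x (f (app s ts)) (app s (f ∘ ts)))
             (section : ∀ t → Eq V x (f (g t)) t) where

      private
        kernel : ℕ → Carrier V x → Carrier V x → Set
        kernel n t u = Eq V x (iterate f n t) (iterate f n u)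

        resp^ : ∀ n {t u} → Eq V x t u → kernel n t u
        resp^ zero    p = p
        resp^ (suc n) p = resp^ n (resp-f p)

        hom^ : ∀ n s ts → Eq V x (iterate f n (app s ts)) (app s (iterate f n ∘ ts))
        hom^ zero    s ts = cg-refl
        hom^ (suc n) s ts = cg-trans (resp^ n (hom s ts)) (hom^ n s (f ∘ ts))

        kernel-congruence : ∀ n → IsCongruence V x (kernel n)
        kernel-congruence n = record
          { θ-⊇ = resp^ n ; θ-refl = cg-refl ; θ-sym = cg-sym ; θ-trans = cg-trans
          ; θ-compat = λ s {ts} {us} p →
              cg-trans (hom^ n s ts) (cg-trans (cg-cong s p) (cg-sym (hom^ n s us))) }

        kernel-grows : ∀ n {t u} → kernel n t u → kernel (suc n) t u
        kernel-grows n {t} {u} p rewrite iterate-shift f n t | iterate-shift f n u = resp-f p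

        section^ : ∀ n t → Eq V x (iterate f n (iterate g n t)) t
        section^ zero    t = cg-refl
        section^ (suc n) t rewrite iterate-shift g n t = cg-trans (resp^ n (section _)) (section^ n t)

        peel : ∀ n t → Eq V x (iterate f (suc n) (iterate g n t)) (f t)
        peel n t rewrite iterate-shift f n (iterate g n t) = resp-f (section^ n t)

      -- The kernels of the iterates of f stabilise, at N say; apply this to N-fold preimages under f.
      hopfian : ∀ {t u} → Eq V x (f t) (f u) → Eq V x t u
      hopfian {t} {u} ft≈fu with acc x kernel kernel-congruence kernel-grows
      ... | N , stable = cg-trans (cg-sym (section^ N t)) (cg-trans
        (stable (suc N) (n≤1+n N) {iterate g N t} {iterate g N u}
          (cg-trans (peel N t) (cg-trans ft≈fu (cg-sym (peel N u)))))
        (section^ N u))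

    -- The endomorphism `map q ∘ map p` has the section `choose p ∘ choose q`, so it is injective,
    -- and `map p` with it. Injectivity then makes `choose p` respect equality and become a
    -- two-sided inverse.
    onto²⇒iso : ∀ {x y} → Onto x y → Onto y x → Iso V x y
    onto²⇒iso {x} {y} p q = record
      { to = map p ; from = choose p ; to-resp = map-resp p
      ; from-resp = λ {t} {u} t≈u → injective
          (cg-trans (map-choose p t) (cg-trans t≈u (cg-sym (map-choose p u))))
      ; to-hom = λ s ts → cg-refl
      ; from-to = λ t → injective (map-choose p (map p t))
      ; to-from = map-choose p }
      where
      section : ∀ t → Eq V x (map q (map p (choose p (choose q t)))) t
      section t = cg-trans (map-resp q (map-choose p (choose q t))) (map-choose q t)
      injective : ∀ {t u} → Eq V y (map p t) (map p u) → Eq V x t u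
      injective h = hopfian x (map q ∘ map p) (choose p ∘ choose q) (map-resp q ∘ map-resp p)
        (λ s ts → cg-refl) section (map-resp q h)

    -- The chain lives in the free algebra on X_{k+1}, presented by an empty W_e.
    finite-stage : ∀ k (R : ℕ → ℕ → Set) → (∀ n {m} → R n m → R (suc n) m) →
      ∃ λ N → ∀ {n m} → R n m → Gen k (R N) (D k (π₁ m)) (D k (π₂ m))
    finite-stage k R grow with acc free (λ n → Gen′ (R n))
        (λ n → record { θ-⊇ = Cg⇒Gen (λ w → contradiction w no-relations)
                      ; θ-refl = gen-refl ; θ-sym = gen-sym ; θ-trans = gen-trans ; θ-compat = gen-cong })
        (λ n → Gen-mono (grow n))
      where
      free : ℕ
      free = ⟪ k , ⌊ diverge ⌋ ⟫
      Gen′ : (ℕ → Set) → Carrier V free → Carrier V free → Set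
      Gen′ = Gen (gens V free)
      no-relations : ∀ {n} → ¬ n ∈W idx V free
      no-relations (y , h) rewrite π₂-⟪⟫ k ⌊ diverge ⌋ | φ-⌊⌋ diverge = diverge-⇑ h
    ... | N , stable rewrite π₁-⟪⟫ k ⌊ diverge ⌋ = N , λ {n} {m} r →
      -- Stability concerns stages from N on, so a relation of an arbitrary stage n is first moved
      -- up to stage N + n.
      stable (N + n) (m≤m+n N n) (gen-rel m (grows N r))
      where
      grows : ∀ j {n m} → R n m → R (j + n) m
      grows zero    r = r
      grows (suc j) r = grow _ (grows j r)

  -- Coding terms

  -- a decodes to the variable i; tags that exceed the number of symbols decode to variable 0.
  IsVar : ℕ → ℕ → ℕ → Set
  IsVar k a i = (π₁ a ≡ 0 × i < suc k × ∃ λ q → ⊤ × π₂ a ≡ i + q * suc k) ⊎ (nsym < π₁ a × i ≡ 0)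

  -- Replaces the computation of `decodeT` by arithmetic facts about a, which the formulas below can
  -- express and which do not mention the fuel.
  data View (k f a : ℕ) : Term V (suc k) → Set where
    view-var : ∀ i → IsVar k a (toℕ i) → View k f a (var i)
    view-app : ∀ s → π₁ a ≡ suc (toℕ s) → View k f a (app s λ i → decodeT V k f (nth (toℕ i) (π₂ a)))

  view : ∀ k f a → View k f a (decodeT V k (suc f) a)
  view k f a with unpair a in eq
  ... | zero , r = view-var _ (inj₁
    ( cong proj₁ eq
    , toℕ<n (fromℕ< (m%n<n r (suc k)))
    , r / suc k , tt
    , trans (cong proj₂ eq) (trans (m≡m%n+[m/n]*n r (suc k))
        (cong (_+ r / suc k * suc k) (sym (toℕ-fromℕ< (m%n<n r (suc k))))))))
  ... | suc s , r with s <? nsym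
  ...   | yes p = subst (λ r′ → View k f a (app (fromℕ< p) λ i → decodeT V k f (nth (toℕ i) r′))) (cong proj₂ eq)
                    (view-app (fromℕ< p) (trans (cong proj₁ eq) (cong suc (sym (toℕ-fromℕ< p)))))
  ...   | no ¬p = view-var zero (inj₂ (subst (nsym <_) (sym (cong proj₁ eq)) (s≤s (≮⇒≥ ¬p)) , refl))

  IsVar-unique : ∀ {k} a {i j} → IsVar k a i → IsVar k a j → i ≡ j
  IsVar-unique {k} _ (inj₁ (_ , i≤k , q , _ , e)) (inj₁ (_ , j≤k , r , _ , e′)) =
    trans (sym (remainder i≤k q)) (trans (cong (_% suc k) (trans (sym e) e′)) (remainder j≤k r))
    where
    remainder : ∀ {i} → i < suc k → ∀ q → (i + q * suc k) % suc k ≡ i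
    remainder {i} i≤k q = trans ([m+kn]%n≡m%n i q (suc k)) (m<n⇒m%n≡m i≤k)
  IsVar-unique _ (inj₁ (e , _)) (inj₂ (p , _)) = contradiction (subst (nsym <_) e p) λ ()
  IsVar-unique _ (inj₂ (p , _)) (inj₁ (e , _)) = contradiction (subst (nsym <_) e p) λ ()
  IsVar-unique _ (inj₂ (_ , e)) (inj₂ (_ , e′)) = trans e (sym e′)

  IsVar-not-app : ∀ {k} a {i} (s : Fin nsym) → π₁ a ≡ suc (toℕ s) → ¬ IsVar k a i
  IsVar-not-app _ s eq (inj₁ (e , _)) with () ← trans (sym eq) e
  IsVar-not-app _ s eq (inj₂ (p , _)) = <-irrefl refl (<-≤-trans p (subst (_≤ nsym) (sym eq) (toℕ<n s)))

  decodeT-fuel : ∀ k f g a → a < f → a < g → decodeT V k f a ≈ decodeT V k g a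
  decodeT-fuel k (suc f) (suc g) a a<f a<g
    with decodeT V k (suc f) a | view k f a | decodeT V k (suc g) a | view k g a
  ... | _ | view-var i p  | _ | view-var j q  rewrite toℕ-injective (IsVar-unique a p q) = ≈-var
  ... | _ | view-var i p  | _ | view-app s eq = contradiction p (IsVar-not-app a s eq)
  ... | _ | view-app s eq | _ | view-var j q  = contradiction q (IsVar-not-app a s eq)
  ... | _ | view-app s eq | _ | view-app s′ eq′
    rewrite toℕ-injective (suc-injective (trans (sym eq) eq′)) = ≈-app λ i →
      decodeT-fuel k f g _ (<-≤-trans (small i) (s≤s⁻¹ a<f)) (<-≤-trans (small i) (s≤s⁻¹ a<g))
    where
    small : ∀ {n} (i : Fin n) → nth (toℕ i) (π₂ a) < a
    small i = nth<-tagged (toℕ i) (cong₂ _,_ eq′ refl)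

  D-var : ∀ {k} a {i} → IsVar k a i → ∃ λ j → toℕ j ≡ i × D k a ≡ var j
  D-var {k} a p with decodeT V k (suc a) a | view k a a
  ... | _ | view-var j q  = j , IsVar-unique a q p , refl
  ... | _ | view-app s eq = contradiction p (IsVar-not-app a s eq)

  D-app : ∀ {k} a s → π₁ a ≡ suc (toℕ s) → D k a ≈ app s (λ i → D k (nth (toℕ i) (π₂ a)))
  D-app {k} a s eq with decodeT V k (suc a) a | view k a a
  ... | _ | view-var j q   = contradiction q (IsVar-not-app a s eq)
  ... | _ | view-app s′ eq′ rewrite toℕ-injective (suc-injective (trans (sym eq′) eq)) = ≈-app λ i →
    decodeT-fuel k a _ _ (nth<-tagged (toℕ i) (cong₂ _,_ eq refl)) ≤-refl

  ⌈_⌉ : ∀ {k} → Term V k → ℕ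
  ⌈ var i ⌉    = ⟪ 0 , toℕ i ⟫
  ⌈ app s ts ⌉ = ⟪ suc (toℕ s) , tuple (arity s) (λ i → ⌈ ts i ⌉) ⟫

  IsVar-⌈⌉ : ∀ {k} (i : Fin (suc k)) → IsVar k ⌈ var i ⌉ (toℕ i)
  IsVar-⌈⌉ i = inj₁ (π₁-⟪⟫ 0 (toℕ i) , toℕ<n i , 0 , tt , trans (π₂-⟪⟫ 0 (toℕ i)) (sym (+-identityʳ (toℕ i))))

  ⌈app⌉-arg : ∀ {k} s (ts : Fin (arity s) → Term V k) i → nth (toℕ i) (π₂ ⌈ app s ts ⌉) ≡ ⌈ ts i ⌉
  ⌈app⌉-arg s ts i = trans (cong (nth (toℕ i)) (π₂-⟪⟫ _ _)) (nth-tuple _ i)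

  D-⌈⌉ : ∀ {k} (t : Term V (suc k)) → D k ⌈ t ⌉ ≈ t
  D-⌈⌉ (var i) with D-var ⌈ var i ⌉ (IsVar-⌈⌉ i)
  ... | j , j≡i , eq rewrite toℕ-injective j≡i = ≡⇒≈ eq
  D-⌈⌉ {k} (app s ts) = ≈-trans (D-app ⌈ app s ts ⌉ s (π₁-⟪⟫ _ _)) (≈-app λ i →
    ≈-trans (≡⇒≈ (cong (D k) (⌈app⌉-arg s ts i))) (D-⌈⌉ (ts i)))

  -- Substitution and equality as Σ₁ rules

  arities : ℕ
  arities = tuple nsym arity

  -- With unrestricted witnesses its meaning is `IsVar` by computation, which explains the factor
  -- `⊤` there.
  isVarᵉ : ∀ {n} → Exp n → Exp n → Exp n → Fm n
  isVarᵉ k a i = fs a == lit 0 ∧ i << su k ∧ ex (sn (wk a) == wk i ⊕ v 0 ⊗ su (wk k))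
               ∨ lit nsym << fs a ∧ i == lit 0

  -- A relation instead of a function: any t′ with the right head symbol and the right entries is
  -- accepted, so no tuple of results has to be built inside a formula.
  subRule : Fm 5
  subRule = ex (isVarᵉ (wk m) (wk t) (v 0) ∧ wk t′ == nt (v 0) (wk σ))
          ∨ ex (v 0 << lit nsym ∧ fs (wk t) == su (v 0) ∧ fs (wk t′) == su (v 0)
               -- The signature is finite, so its arity function is a single literal.
               ∧ all< (nt (v 0) (lit arities))
                   (mem (subᵉ (wk (wk m)) (wk (wk σ)) (nt (v 0) (sn (wk (wk t)))) (nt (v 0) (sn (wk (wk t′)))))))
    where
    t′ t σ m : Exp 5
    t′ = v 0
    t  = v 1
    σ  = v 2
    m  = v 3

  -- The clauses follow the constructors of `Cg`, except that reflexivity is replaced by equality of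
  -- two codes of the same variable. Decoding is not injective; this clause and congruence together
  -- identify different codes of one term.
  eqnRule : Fm 4
  eqnRule = ex (ex (mem (evᵉ (sn (wk (wk x))) (v 1) (v 0)) ∧ wk (wk a) == fs (v 1) ∧ wk (wk b) == sn (v 1)))
          -- Here `v 2` is the law, `v 1` the value witnessing that it belongs to the set of laws,
          -- and `v 0` the tuple of terms substituted.
          ∨ ex (ex (ex (mem (evᵉ (lit lawIdx) (v 2) (v 1))
                       ∧ mem (subᵉ (fs (v 2)) (v 0) (fs (sn (v 2))) (wk (wk (wk a))))
                       ∧ mem (subᵉ (fs (v 2)) (v 0) (sn (sn (v 2))) (wk (wk (wk b)))))))
          ∨ ex (isVarᵉ (fs (wk x)) (wk a) (v 0) ∧ isVarᵉ (fs (wk x)) (wk b) (v 0))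
          ∨ mem (eqnᵉ x b a)
          ∨ ex (mem (eqnᵉ (wk x) (wk a) (v 0)) ∧ mem (eqnᵉ (wk x) (v 0) (wk b)))
          ∨ ex (v 0 << lit nsym ∧ fs (wk a) == su (v 0) ∧ fs (wk b) == su (v 0)
               ∧ all< (nt (v 0) (lit arities))
                   (mem (eqnᵉ (wk (wk x)) (nt (v 0) (sn (wk (wk a)))) (nt (v 0) (sn (wk (wk b)))))))
    where
    b a x : Exp 4
    b = v 0
    a = v 1
    x = v 2

  rule : Fm 1
  rule = ex (ex (ex (v 3 == evᵉ (v 2) (v 1) (v 0) ∧ evRule)))
       ∨ ex (ex (ex (ex (v 4 == subᵉ (v 3) (v 2) (v 1) (v 0) ∧ subRule))))
       ∨ ex (ex (ex (v 3 == eqnᵉ (v 2) (v 1) (v 0) ∧ eqnRule)))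

  -- Soundness of the rule

  open Derivation rule public

  -- A fact `Sub` does not name its target, so its meaning ranges over all target algebras. Equality
  -- is taken up to the congruence because decoding controls arguments only pointwise.
  SubstHolds : ℕ → ℕ → ℕ → ℕ → Set
  SubstHolds m σ t t′ = ∀ {k e} →
    Cg V k e (D k t′) (substT V (λ i → D k (nth (toℕ i) σ)) (D m t))

  Meaning : ℕ → ℕ → Set
  Meaning 0 u = φ (π₁ u) ⟨ π₁ (π₂ u) ⟩⇓ π₂ (π₂ u)
  Meaning 1 u = SubstHolds (π₁ u) (π₁ (π₂ u)) (π₁ (π₂ (π₂ u))) (π₂ (π₂ (π₂ u)))
  Meaning 2 u = Eq V (π₁ u) (D (gens V (π₁ u)) (π₁ (π₂ u))) (D (gens V (π₁ u)) (π₂ (π₂ u)))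
  Meaning _ u = ⊤

  True : ℕ → Set
  True u = Meaning (π₁ u) (π₂ u)

  True-Ev : ∀ e x y → True (Ev e x y) ≡ (φ e ⟨ x ⟩⇓ y)
  True-Ev e x y rewrite unpair-⟪⟫ 0 ⟪ e , ⟪ x , y ⟫ ⟫ | unpair-⟪⟫ e ⟪ x , y ⟫ | unpair-⟪⟫ x y = refl

  True-Sub : ∀ m σ t t′ → True (Sub m σ t t′) ≡ SubstHolds m σ t t′
  True-Sub m σ t t′ rewrite unpair-⟪⟫ 1 ⟪ m , ⟪ σ , ⟪ t , t′ ⟫ ⟫ ⟫ | unpair-⟪⟫ m ⟪ σ , ⟪ t , t′ ⟫ ⟫
    | unpair-⟪⟫ σ ⟪ t , t′ ⟫ | unpair-⟪⟫ t t′ = refl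

  True-Eqn : ∀ x a b → True (Eqn x a b) ≡ Eq V x (D (gens V x) a) (D (gens V x) b)
  True-Eqn x a b rewrite unpair-⟪⟫ 2 ⟪ x , ⟪ a , b ⟫ ⟫ | unpair-⟪⟫ x ⟪ a , b ⟫ | unpair-⟪⟫ a b = refl

  private
    read : ∀ {A B : Set} → A ≡ B → A → B
    read = subst id

    write : ∀ {A B : Set} → A ≡ B → B → A
    write eq = subst id (sym eq)

  arities-nth : ∀ {s} (p : s < nsym) → nth s arities ≡ arity (fromℕ< p)
  arities-nth p = nth-tuple-< arity p

  subRule-sound : ∀ {t′ t σ m u} → ⟦ subRule ⟧ (λ _ → ⊤) True (t′ ∷ t ∷ σ ∷ m ∷ u ∷ []) → SubstHolds m σ t t′
  subRule-sound {t = t} {σ} {m} (inj₁ (i , _ , p , refl)) {k} with D-var t p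
  ... | j , refl , eq = ≡⇒Cg (cong (substT V (λ i → D k (nth (toℕ i) σ))) (sym eq))
  subRule-sound {t′} {t} {σ} {m} (inj₂ (s , _ , s<nsym , t≡ , t′≡ , args)) {k} =
    cg-trans (≈⇒Cg (D-app t′ (fromℕ< s<nsym) (trans t′≡ s≡))) (cg-trans
      (cg-cong (fromℕ< s<nsym) λ i →
        read (True-Sub _ _ _ _) (args (toℕ i) (subst (toℕ i <_) (sym (arities-nth s<nsym)) (toℕ<n i))))
      (cg-sym (≈⇒Cg (≈-substT (λ i → D k (nth (toℕ i) σ)) (D-app t (fromℕ< s<nsym) (trans t≡ s≡))))))
    where
    s≡ : suc s ≡ suc (toℕ (fromℕ< s<nsym))
    s≡ = cong suc (sym (toℕ-fromℕ< s<nsym))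

  eqnRule-sound : ∀ {b a x u} → ⟦ eqnRule ⟧ (λ _ → ⊤) True (b ∷ a ∷ x ∷ u ∷ []) →
                  Eq V x (D (gens V x) a) (D (gens V x) b)
  eqnRule-sound (case₀ (n , _ , y , _ , p , refl , refl)) = cg-rel n (y , read (True-Ev _ _ _) p)
  eqnRule-sound {x = x} (case₁ (n , _ , y , _ , σ , _ , p , q , r)) =
    cg-trans (read (True-Sub _ _ _ _) q) (cg-trans
      (cg-law n (y , read (True-Ev _ _ _) p) (λ i → D (gens V x) (nth (toℕ i) σ)))
      (cg-sym (read (True-Sub _ _ _ _) r)))
  eqnRule-sound {b} {a} {x} (case₂ (i , _ , p , q)) with D-var a p | D-var b q
  ... | j , j≡ , eq | j′ , j′≡ , eq′ =
    ≡⇒Cg (trans eq (trans (cong var (toℕ-injective (trans j≡ (sym j′≡)))) (sym eq′)))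
  eqnRule-sound (case₃ p) = cg-sym (read (True-Eqn _ _ _) p)
  eqnRule-sound (case₄ (c , _ , p , q)) = cg-trans (read (True-Eqn _ _ _) p) (read (True-Eqn _ _ _) q)
  eqnRule-sound {b} {a} (inj₂ (inj₂ (inj₂ (inj₂ (inj₂ (s , _ , s<nsym , a≡ , b≡ , args)))))) =
    cg-trans (≈⇒Cg (D-app a (fromℕ< s<nsym) (trans a≡ s≡))) (cg-trans
      (cg-cong (fromℕ< s<nsym) λ i →
        read (True-Eqn _ _ _) (args (toℕ i) (subst (toℕ i <_) (sym (arities-nth s<nsym)) (toℕ<n i))))
      (cg-sym (≈⇒Cg (D-app b (fromℕ< s<nsym) (trans b≡ s≡)))))
    where
    s≡ : suc s ≡ suc (toℕ (fromℕ< s<nsym))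
    s≡ = cong suc (sym (toℕ-fromℕ< s<nsym))

  rule-sound : ∀ u → Step (λ _ → ⊤) True u → True u
  rule-sound _ (inj₁ (e , _ , x , _ , y , _ , refl , p)) =
    write (True-Ev _ _ _) (evRule-sound True (λ {e} {x} {y} → read (True-Ev e x y)) {u = Ev e x y} p)
  rule-sound _ (inj₂ (inj₁ (m , _ , σ , _ , t , _ , t′ , _ , refl , p))) =
    write (True-Sub _ _ _ _) (subRule-sound {t′} {t} {σ} {m} {Sub m σ t t′} p)
  rule-sound _ (inj₂ (inj₂ (x , _ , a , _ , b , _ , refl , p))) =
    write (True-Eqn _ _ _) (eqnRule-sound {b} {a} {x} {Eqn x a b} p)

  Derivable⇒True : ∀ {u} → Derivable u → True u
  Derivable⇒True = derivable-ind True rule-sound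

  -- Completeness of the rule

  derivable-Ev : ∀ {e x y} → Derivable (Ev e x y) ⇔ (φ e ⟨ x ⟩⇓ y)
  derivable-Ev = mk⇔ (λ d → read (True-Ev _ _ _) (Derivable⇒True d))
    (evRule-complete Derivable λ {y} {x} {e} p → derive (inj₁ (e , tt , x , tt , y , tt , refl , p (Ev e x y))))

  derivable-sub : ∀ {m k} (σ : Fin (suc m) → Term V (suc k)) f a → a < f →
    Derivable (Sub m (tuple (suc m) (⌈_⌉ ∘ σ)) a ⌈ substT V σ (decodeT V m f a) ⌉)
  derivable-sub {m} σ (suc f) a a<f with decodeT V m (suc f) a | view m f a
  ... | _ | view-var i p = derive (inj₂ (inj₁ (_ , tt , _ , tt , _ , tt , _ , tt , refl ,
    inj₁ (toℕ i , tt , p , sym (nth-tuple (⌈_⌉ ∘ σ) i)))))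
  ... | _ | view-app s eq = derive (inj₂ (inj₁ (_ , tt , _ , tt , _ , tt , _ , tt , refl ,
    inj₂ (toℕ s , tt , toℕ<n s , eq , π₁-⟪⟫ _ _ , λ i i< → arg (subst (i <_) (nth-tuple arity s) i<)))))
    where
    ts : Fin (arity s) → Term V (suc m)
    ts i = decodeT V m f (nth (toℕ i) (π₂ a))
    arg : ∀ {i} → i < arity s → Derivable (Sub m (tuple (suc m) (⌈_⌉ ∘ σ)) (nth i (π₂ a))
                                     (nth i (π₂ ⌈ substT V σ (app s ts) ⌉)))
    arg {i} i< with fromℕ< i< | toℕ-fromℕ< i<
    ... | j | refl rewrite ⌈app⌉-arg s (substT V σ ∘ ts) j =
      derivable-sub σ f _ (<-≤-trans (nth<-tagged (toℕ j) (cong₂ _,_ eq refl)) (s≤s⁻¹ a<f))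

  module _ {x : ℕ} where

    private
      k : ℕ
      k = gens V x
      infix 4 _∼_
      _∼_ : ℕ → ℕ → Set
      a ∼ b = Derivable (Eqn x a b)

      eqn : ∀ {a b} → Holds eqnRule (b ∷ a ∷ x ∷ Eqn x a b ∷ []) → a ∼ b
      eqn p = derive (inj₂ (inj₂ (_ , tt , _ , tt , _ , tt , refl , p)))

      ∼-sym : ∀ {a b} → a ∼ b → b ∼ a
      ∼-sym p = eqn (case₃ p)

      ∼-trans : ∀ {a b c} → a ∼ b → b ∼ c → a ∼ c
      ∼-trans p q = eqn (case₄ (_ , tt , p , q))

      ∼-cong : ∀ {a b} s → π₁ a ≡ suc (toℕ s) → π₁ b ≡ suc (toℕ s) →
               (∀ (i : Fin (arity s)) → nth (toℕ i) (π₂ a) ∼ nth (toℕ i) (π₂ b)) → a ∼ b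
      ∼-cong {a} {b} s p q args = eqn (inj₂ (inj₂ (inj₂ (inj₂ (inj₂
        (toℕ s , tt , toℕ<n s , p , q , λ i i< → arg (subst (i <_) (nth-tuple arity s) i<)))))))
        where
        arg : ∀ {i} → i < arity s → nth i (π₂ a) ∼ nth i (π₂ b)
        arg i< = subst (λ i → nth i (π₂ a) ∼ nth i (π₂ b)) (toℕ-fromℕ< i<) (args (fromℕ< i<))

      -- Links the arbitrary codes occurring in relations to the canonical codes of the terms they
      -- denote; reflexivity is recovered from it as well.
      ∼-normal : ∀ f a → a < f → a ∼ ⌈ decodeT V k f a ⌉
      ∼-normal (suc f) a a<f with decodeT V k (suc f) a | view k f a
      ... | _ | view-var i p = eqn (case₂ (toℕ i , tt , p , IsVar-⌈⌉ i))
      ... | _ | view-app s eq = ∼-cong s eq (π₁-⟪⟫ _ _) λ i →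
        subst (nth (toℕ i) (π₂ a) ∼_) (sym (⌈app⌉-arg s (λ i → decodeT V k f (nth (toℕ i) (π₂ a))) i))
          (∼-normal f _ (<-≤-trans (nth<-tagged (toℕ i) (cong₂ _,_ eq refl)) (s≤s⁻¹ a<f)))

      ∼-refl : ∀ {a} → a ∼ a
      ∼-refl = ∼-trans (∼-normal _ _ ≤-refl) (∼-sym (∼-normal _ _ ≤-refl))

    derivable-eqn : ∀ {t u} → Eq V x t u → Derivable (Eqn x ⌈ t ⌉ ⌈ u ⌉)
    derivable-eqn (cg-rel n (y , h)) = ∼-trans (∼-sym (∼-normal _ (π₁ n) ≤-refl)) (∼-trans
      (eqn (case₀ (n , tt , y , tt , Equivalence.from derivable-Ev h , refl , refl)))
      (∼-normal _ (π₂ n) ≤-refl))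
    derivable-eqn (cg-law n (y , h) σ) = eqn (case₁ (n , tt , y , tt , _ , tt ,
      Equivalence.from derivable-Ev h , derivable-sub σ _ _ ≤-refl , derivable-sub σ _ _ ≤-refl))
    derivable-eqn cg-refl = ∼-refl
    derivable-eqn (cg-sym p) = ∼-sym (derivable-eqn p)
    derivable-eqn (cg-trans p q) = ∼-trans (derivable-eqn p) (derivable-eqn q)
    derivable-eqn (cg-cong s {ts} {us} p) = ∼-cong s (π₁-⟪⟫ _ _) (π₁-⟪⟫ _ _) λ i →
      subst₂ _∼_ (sym (⌈app⌉-arg s ts i)) (sym (⌈app⌉-arg s us i)) (derivable-eqn (p i))

  -- Stages of a c.e. set and the invariant

  evaluates : Fm 2
  evaluates = ex (mem (evᵉ (v 1) (v 2) (v 0)))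

  opaque
    check : ℕ → ℕ → ℕ
    check = stage evaluates

    checkC : Computes₂ check
    checkC = stageC evaluates

    check-sound : ∀ {e} d → check e d ≡ 0 → π₁ d ∈W e
    check-sound {e} d w with stage-sound evaluates {e} {d} w
    ... | y , _ , p = y , to derivable-Ev p

    check-complete : ∀ {e n} → n ∈W e → ∃ λ d → check e d ≡ 0 × π₁ d ≡ n
    check-complete {e} {n} (y , h) = stage-complete evaluates {e} {n} (y , tt , from derivable-Ev h)

  -- (x′, s) belongs to the invariant of x; exp expresses the generators of x through the tuple gen.
  record Realises (x x′ s : ℕ) : Set where
    field
      gen : Fin (suc (gens V x′)) → Carrier V x
      exp : Fin (suc (gens V x)) → Carrier V x′
      generates : ∀ i → Eq V x (substT V gen (exp i)) (var i)
      satisfies : ∀ d → d < s → check (idx V x′) d ≡ 0 →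
                  Eq V x (substT V gen (D (gens V x′) (π₁ (π₁ d))))
                         (substT V gen (D (gens V x′) (π₂ (π₁ d))))

  -- Directly inside the two outer quantifiers, `v 1` is the tuple of codes for `gen`, `v 0` that
  -- for `exp`, `v 2` is x and `v 3` is the pair of x′ and s. Being an enumerated relation is a
  -- hypothesis of `satisfies`, a negative position, so it appears as the computed value of `check`
  -- and not as a derivable fact.
  realises : Fm 2
  realises = ex (ex
    ( all< (su (fs (v 2)))
        (ex (mem (subᵉ (fs (fs (v 5))) (v 3) (nt (v 1) (v 2)) (v 0)) ∧ mem (eqnᵉ (v 4) (v 0) (pr (lit 0) (v 1)))))
    ∧ all< (sn (v 3))
        ( op₂ check checkC (sn (fs (v 4))) (v 0) =/= lit 0
        ∨ ex (ex ( mem (subᵉ (fs (fs (v 6))) (v 4) (fs (fs (v 2))) (v 1))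
                 ∧ mem (subᵉ (fs (fs (v 6))) (v 4) (sn (fs (v 2))) (v 0))
                 ∧ mem (eqnᵉ (v 5) (v 1) (v 0)))))))

  realises-sound : ∀ {x z} → Holds realises (x ∷ z ∷ []) → Realises x (π₁ z) (π₂ z)
  realises-sound {x} {z} (τ , _ , σ , _ , p , q) = record
    { gen = gen ; exp = λ i → D k′ (nth (toℕ i) σ)
    ; generates = λ i → let (w , _ , s , e) = p (toℕ i) (toℕ<n i) in
        cg-trans (cg-sym (substitutes s)) (cg-trans (equality e) (≈⇒Cg (D-⌈⌉ (var i))))
    ; satisfies = satisfies }
    where
    k k′ : ℕ
    k  = gens V x
    k′ = gens V (π₁ z)
    gen : Fin (suc k′) → Carrier V x
    gen i = D k (nth (toℕ i) τ)
    substitutes : ∀ {t t′} → Derivable (Sub k′ τ t t′) → Eq V x (D k t′) (substT V gen (D k′ t))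
    substitutes {t} {t′} d = read (True-Sub k′ τ t t′) (Derivable⇒True d) {k} {idx V x}
    equality : ∀ {a b} → Derivable (Eqn x a b) → Eq V x (D k a) (D k b)
    equality {a} {b} d = read (True-Eqn x a b) (Derivable⇒True d)
    satisfies : ∀ d → d < π₂ z → check (idx V (π₁ z)) d ≡ 0 →
                Eq V x (substT V gen (D k′ (π₁ (π₁ d)))) (substT V gen (D k′ (π₂ (π₁ d))))
    satisfies d d<s w with q d d<s
    ... | inj₁ ¬w = contradiction w ¬w
    ... | inj₂ (_ , _ , _ , _ , s₁ , s₂ , e) =
      cg-trans (cg-sym (substitutes s₁)) (cg-trans (equality e) (substitutes s₂))

  realises-complete : ∀ {x z} → Realises x (π₁ z) (π₂ z) → Holds realises (x ∷ z ∷ [])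
  realises-complete {x} {z} r = τ , tt , σ , tt , generates′ , satisfies′
    where
    open Realises r
    k k′ : ℕ
    k  = gens V x
    k′ = gens V (π₁ z)
    τ σ : ℕ
    τ = tuple (suc k′) (⌈_⌉ ∘ gen)
    σ = tuple (suc k) (⌈_⌉ ∘ exp)
    generator : ∀ i → Derivable (Sub k′ τ (nth (toℕ i) σ) ⌈ substT V gen (D k′ (nth (toℕ i) σ)) ⌉)
                    × Derivable (Eqn x ⌈ substT V gen (D k′ (nth (toℕ i) σ)) ⌉ ⟪ 0 , toℕ i ⟫)
    generator i rewrite nth-tuple (⌈_⌉ ∘ exp) i =
      derivable-sub gen _ _ ≤-refl ,
      derivable-eqn (cg-trans (≈⇒Cg (≈-substT gen (D-⌈⌉ (exp i)))) (generates i))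
    generates′ : ∀ i → i < suc k → ∃ λ w → ⊤ × Derivable (Sub k′ τ (nth i σ) w) × Derivable (Eqn x w ⟪ 0 , i ⟫)
    generates′ i i≤k = subst (λ i → ∃ λ w → ⊤ × Derivable (Sub k′ τ (nth i σ) w) × Derivable (Eqn x w ⟪ 0 , i ⟫))
      (toℕ-fromℕ< i≤k) (_ , tt , generator (fromℕ< i≤k))
    satisfies′ : ∀ d → d < π₂ z → ¬ check (idx V (π₁ z)) d ≡ 0 ⊎
      ∃ λ w → ⊤ × ∃ λ w′ → ⊤ × Derivable (Sub k′ τ (π₁ (π₁ d)) w)
                               × Derivable (Sub k′ τ (π₂ (π₁ d)) w′) × Derivable (Eqn x w w′)
    satisfies′ d d<s with check (idx V (π₁ z)) d ≟ 0
    ... | no ¬w = inj₁ ¬w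
    ... | yes w = inj₂ (_ , tt , _ , tt ,
      derivable-sub gen _ _ ≤-refl , derivable-sub gen _ _ ≤-refl , derivable-eqn (satisfies d d<s w))

  opaque
    realises-semidecidable : Σ (ℕ → ℕ) λ h → Computable h × (∀ x z → z ∈W h x ⇔ Realises x (π₁ z) (π₂ z))
    realises-semidecidable = map₂ (map₂ λ spec x z → mk⇔
      (λ p → realises-sound {x} {z} (to (spec x z) p))
      (λ r → from (spec x z) (realises-complete {x} {z} r))) (uniformly-ce realises)

  -- Isomorphism invariance and completeness of the invariant

  iso-sym : ∀ {x y} → Iso V x y → Iso V y x
  iso-sym {x} {y} f = record
    { to = f.from ; from = f.to ; to-resp = f.from-resp ; from-resp = f.to-resp
    ; to-hom = λ s ts → cg-trans
        (f.from-resp (cg-sym (cg-trans (f.to-hom s (f.from ∘ ts)) (cg-cong s λ i → f.to-from (ts i)))))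
        (f.from-to (app s (f.from ∘ ts)))
    ; from-to = f.to-from ; to-from = f.from-to }
    where module f = Iso f

  realises-iso : ∀ {x y x′ s} → Iso V x y → Realises x x′ s → Realises y x′ s
  realises-iso {x} {y} {x′} f r = record
    { gen = f.to ∘ gen
    -- A generator of y is pulled back to a term over the generators of x, and these are then
    -- expressed through the tuple.
    ; exp = λ i → substT V exp (f.from (var i))
    ; generates = λ i → cg-trans (cg-sym (to-substT (substT V exp (f.from (var i)))))
        (cg-trans (f.to-resp (expands (f.from (var i)))) (f.to-from (var i)))
    ; satisfies = λ d d<s w → cg-trans (cg-sym (to-substT (D (gens V x′) (π₁ (π₁ d)))))
        (cg-trans (f.to-resp (satisfies d d<s w)) (to-substT (D (gens V x′) (π₂ (π₁ d))))) }
    where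
    module f = Iso f
    open Realises r
    to-substT : ∀ t → Eq V y (f.to (substT V gen t)) (substT V (f.to ∘ gen) t)
    to-substT (var i)    = cg-refl
    to-substT (app s ts) = cg-trans (f.to-hom s _) (cg-cong s λ i → to-substT (ts i))
    expands : ∀ t → Eq V x (substT V gen (substT V exp t)) t
    expands t = cg-trans (≈⇒Cg (substT-∘ gen exp t))
      (cg-trans (Cg-substT generates t) (≈⇒Cg (substT-var t)))

  realises-self : ∀ x s → Realises x x s
  realises-self x s = record
    { gen = var ; exp = var ; generates = λ i → cg-refl
    ; satisfies = λ d _ w → cg-trans (≈⇒Cg (substT-var (D (gens V x) (π₁ (π₁ d)))))
        (cg-trans (cg-rel (π₁ d) (check-sound d w))
          (cg-sym (≈⇒Cg (substT-var (D (gens V x) (π₂ (π₁ d))))))) }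

  module _ (acc : ACC V) where

    Stage : ℕ → ℕ → ℕ → Set
    Stage e s n = ∃ λ d → d < s × check e d ≡ 0 × π₁ d ≡ n

    -- The relations before stage N entail all relations of x modulo the laws, so a tuple that
    -- satisfies them defines a homomorphism. N depends on x alone and serves every y.
    realises⇒onto : ∀ x → ∃ λ N → ∀ y → Realises y x N → Onto x y
    realises⇒onto x with finite-stage acc (gens V x) (Stage (idx V x))
                           (λ s (d , d<s , w) → d , m≤n⇒m≤1+n d<s , w)
    ... | N , finite = N , λ y r → let open Realises r in record
      { img = gen ; pre = exp ; surj = generates
      ; map-resp = λ t≈u → Gen-lift gen
          (λ { (d , d<N , w , refl) → satisfies d d<N w }) (Cg⇒Gen staged t≈u) }
      where
      staged : ∀ {n} → n ∈W idx V x → Gen (gens V x) (Stage (idx V x) N) (D (gens V x) (π₁ n)) (D (gens V x) (π₂ n))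
      staged p with check-complete p
      -- Stages are strict bounds: what d enumerates is present from stage `suc d` on.
      ... | d , w , eq = finite {suc d} (d , ≤-refl , w , eq)

    realises-same⇒iso : ∀ {x y} → (∀ x′ s → Realises x x′ s ⇔ Realises y x′ s) → Iso V x y
    realises-same⇒iso {x} {y} same with realises⇒onto x | realises⇒onto y
    ... | N , x↠ | M , y↠ = onto²⇒iso acc
      (x↠ y (to (same x N) (realises-self x N))) (y↠ x (from (same y M) (realises-self y M)))

theorem4p20 : (V : Variety) → ACC V → _≅fg_ V ≤c _=ce_
theorem4p20 V acc with realises-semidecidable V
... | h , comp , spec = h , comp , λ x y → mk⇔ (forward x y) (backward x y)
  where
  forward : ∀ x y → Iso V x y → h x =ce h y
  forward x y f z = mk⇔
    (λ p → from (spec y z) (realises-iso V f (to (spec x z) p)))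
    (λ p → from (spec x z) (realises-iso V (iso-sym V f) (to (spec y z) p)))
  backward : ∀ x y → h x =ce h y → Iso V x y
  backward x y same = realises-same⇒iso V acc λ x′ s → mk⇔
    (transfer {x} {y} x′ s λ z → to (same z)) (transfer {y} {x} x′ s λ z → from (same z))
    where
    transfer : ∀ {x y} x′ s → (∀ z → z ∈W h x → z ∈W h y) → Realises V x x′ s → Realises V y x′ s
    transfer {x} {y} x′ s incl r =
      subst₂ (Realises V y) (π₁-⟪⟫ x′ s) (π₂-⟪⟫ x′ s)
        (to (spec y ⟪ x′ , s ⟫) (incl ⟪ x′ , s ⟫ (from (spec x ⟪ x′ , s ⟫)
          (subst₂ (Realises V x) (sym (π₁-⟪⟫ x′ s)) (sym (π₂-⟪⟫ x′ s)) r))))
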